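{- Let $a, b \in \mathbb{Z}$, $n \in \mathbb{N}$, let $g: \mathbb{N} \to \mathbb{Z}$ be an arithmetic function with $g(1) = 1$, let $m \geq 3$ and let $\zeta_m$ be a primitive $m$-th root of unity. \begin{enumerate} \item If $m$ is divisible by an odd prime and $2 \nmid a$, then $P_n^g(a\zeta_m + b) \neq 0$. \item If $m$ is divisible by a prime $p > 3$ or by $4$, and $3 \nmid a$, and $g(3) \equiv 0$ or $1 \pmod 3$, then $P_n^g(a\zeta_m + b) \neq 0$. \item If $D \equiv 5 \pmod 8$ is square-free and $2 \nmid a$, then $P_n^g(a\omega_D + b) \neq 0$. \item If $D \equiv 2 \pmod 3$ is square-free, $3 \nmid a$, and $g(3) \equiv 0$ or $1 \pmod 3$, then $P_n^g(a\omega_D + b) \neq 0$. \end{enumerate}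
   Context: For an arithmetic function $g:\mathbb{N}\to\mathbb{Z}$ with $g(1)=1$, the polynomials $P_n^g(X) \in \mathbb{Q}[X]$ are defined by the formal power series identity \[\sum_{n=0}^\infty P_n^g(X) q^n = \exp\Big(X \sum_{n=1}^\infty g(n)\frac{q^n}{n}\Big).\] For a square-free integer $D \notin \{0,1\}$, set $\omega_D = \sqrt{D}$ if $D \not\equiv 1 \pmod 4$ and $\omega_D = \frac{1+\sqrt{D}}{2}$ if $D \equiv 1 \pmod 4$. -}

module Defs where

open import Level using (Level; _⊔_)
open import Algebra.Bundles using (CommutativeRing)
open import Data.Nat as ℕ using (ℕ; zero; suc; _!; _∸_)
open import Data.Nat.Properties using (_!≢0)
import Data.Nat.Divisibility as ℕᵈ
open import Data.Integer as ℤ using (ℤ; +_; -[1+_])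
open import Data.Rational as ℚ using (ℚ; ↥_; ↧ₙ_)
open import Relation.Nullary using (¬_)
open import Relation.Binary.PropositionalEquality using (_≡_)
open import Data.Product using (_×_)

PowerSeries : Set
PowerSeries = ℕ → ℚ

sumℚ : ℕ → (ℕ → ℚ) → ℚ
sumℚ zero    f = f 0
sumℚ (suc n) f = sumℚ n f ℚ.+ f (suc n)

_·ₚ_ : PowerSeries → PowerSeries → PowerSeries
(F ·ₚ H) n = sumℚ n (λ i → F i ℚ.* H (n ∸ i))

oneₚ : PowerSeries
oneₚ zero    = ℚ.1ℚ
oneₚ (suc _) = ℚ.0ℚ

_^ₚ_ : PowerSeries → ℕ → PowerSeries
F ^ₚ zero  = oneₚ
F ^ₚ suc k = F ·ₚ (F ^ₚ k)

Gseries : (ℕ → ℤ) → PowerSeries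
Gseries g zero    = ℚ.0ℚ
Gseries g (suc j) = g (suc j) ℚ./ suc j

-- exp(X·G) = Σ_k X^k G^k / k!, so the coefficient of q^n X^k is
-- [q^n](G^k) / k!.  (Since G has no constant term, [q^n] G^k = 0 for k > n.)
-- Pcoef g n k = coefficient of X^k in P_n^g(X).
Pcoef : (ℕ → ℤ) → ℕ → ℕ → ℚ
Pcoef g n k = ((Gseries g ^ₚ k) n) ℚ.* (ℤ.1ℤ ℚ./ (k !)) {{k !≢0}}

module RingOps {c ℓ : Level} (R : CommutativeRing c ℓ) where
  open CommutativeRing R

  fromℕ : ℕ → Carrier
  fromℕ zero    = 0#
  fromℕ (suc n) = 1# + fromℕ n

  fromℤ : ℤ → Carrier
  fromℤ (+ n)      = fromℕ n
  fromℤ -[1+ n ]   = - fromℕ (suc n)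

  _^_ : Carrier → ℕ → Carrier
  x ^ zero  = 1#
  x ^ suc k = x * (x ^ k)

  sumK : ℕ → (ℕ → Carrier) → Carrier
  sumK zero    f = f 0
  sumK (suc n) f = sumK n f + f (suc n)

record CharZeroField (c ℓ : Level) : Set (Level.suc (c ⊔ ℓ)) where
  field
    cring : CommutativeRing c ℓ
  open CommutativeRing cring public
  open RingOps cring public
  field
    _⁻¹       : Carrier → Carrier
    inverseʳ  : ∀ x → ¬ (x ≈ 0#) → (x * (x ⁻¹)) ≈ 1#
    1≉0       : ¬ (1# ≈ 0#)
    charZero  : ∀ n → ¬ (fromℕ (suc n) ≈ 0#)

module FieldOps {c ℓ : Level} (K : CharZeroField c ℓ) where
  open CharZeroField K

  fromℚ : ℚ → Carrier
  fromℚ q = fromℤ (↥ q) * (fromℕ (↧ₙ q) ⁻¹)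

  -- evaluation of P_n^g at α (deg P_n^g ≤ n)
  evalP : (ℕ → ℤ) → ℕ → Carrier → Carrier
  evalP g n α = sumK n (λ k → fromℚ (Pcoef g n k) * (α ^ k))

  PrimitiveRoot : ℕ → Carrier → Set ℓ
  PrimitiveRoot m ζ = ((ζ ^ m) ≈ 1#) × (∀ k → 1 ℕ.≤ k → k ℕ.< m → ¬ ((ζ ^ k) ≈ 1#))

  IsSqrt : ℤ → Carrier → Set ℓ
  IsSqrt D s = (s * s) ≈ fromℤ D

  -- ω_D, given a chosen square root s of D:
  -- ω_D = (1+s)/2 if D ≡ 1 (mod 4), ω_D = s otherwise
  omega : ℤ → Carrier → Carrier
  omega D s with ℤ._%ℕ_ D 4
  ... | 1 = (1# + s) * (fromℕ 2 ⁻¹)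
  ... | _ = s

SquareFree : ℤ → Set
SquareFree D = ∀ (k : ℕ) → (k ℕ.* k) ℕᵈ.∣ ℤ.∣ D ∣ → k ≡ 1

{-# OPTIONS --safe #-}
-- Write A_n = n! P_n(α).  Differentiating the generating function gives
--   A_{n+1} = α Σ_j g(j+1) n(n-1)...(n-j+1) A_{n-j},
-- so A_n lies in ℤ[α].  Modulo p only the terms j < p survive and A_n becomes a product
-- of factors α, α + g(2) (p = 2), or α, α + g(2), α² - g(3) (p = 3); under the hypothesis
-- on g(3) these split into linear factors.  For α = aθ + b with p ∤ a each linear factor is
-- a unit modulo p, because θ - c divides an integer prime to p for every residue c.  Hence
-- A_n = 0 would make p a unit in a ring that is finitely generated as a ℤ-module, which
-- Nakayama's lemma excludes in characteristic zero.
module Submission where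

open import Defs
open import Level using (Level; _⊔_)
open import Algebra.Bundles using (CommutativeMonoid; CommutativeRing)
import Algebra.Properties.AbelianGroup as AbelianGroupProperties
import Algebra.Properties.CommutativeSemigroup as CommutativeSemigroupProperties
import Algebra.Properties.Ring as RingProperties
import Algebra.Solver.Ring
open import Algebra.Solver.Ring.AlmostCommutativeRing
  using (fromCommutativeRing; _-Raw-AlmostCommutative⟶_)
open import Data.Fin using (zero; suc)
open import Data.Integer as ℤ using (ℤ; +_; -[1+_])
open import Data.Integer.Divisibility as ℤᵈ using ()
import Data.Integer.Divisibility.Signed as ℤˢ
open import Data.Integer.DivMod using (n%ℕd<d; a≡a%ℕn+[a/ℕn]*n)
import Data.Integer.Properties as ℤₚ
open import Data.Integer.Solver using () renaming (module +-*-Solver to ℤS)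
open import Data.List using (List; []; _∷_)
open import Data.List.Membership.Propositional using (_∈_)
open import Data.List.Relation.Unary.All as All using (All; []; _∷_)
open import Data.List.Relation.Unary.Any using (here; there)
open import Data.Maybe using (Maybe; just; nothing)
open import Data.Nat as ℕ using (ℕ; zero; suc; _∸_; z≤n; s≤s; _!)
open import Data.Nat.Combinatorics.Base using (_P′_)
open import Data.Nat.Divisibility as ℕᵈ using ()
open import Data.Nat.DivMod using (_divMod_; result)
open import Data.Nat.Primality
  using (Prime; prime?; prime[2]; ¬prime[1]; prime⇒irreducible; prime⇒nonTrivial)
import Data.Nat.Properties as ℕₚ
open import Data.Product using (_×_; _,_; proj₁; proj₂; ∃-syntax)
open import Data.Rational as ℚ using (ℚ; ↥_; ↧_; toℚᵘ)
import Data.Rational.Properties as ℚₚ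
open import Data.Rational.Unnormalised as ℚᵘ using (mkℚᵘ)
open import Data.Sum as Sum using (_⊎_; inj₁; inj₂)
open import Function using (_∘_)
open import Relation.Binary.PropositionalEquality as ≡ using (_≡_; _≢_)
import Relation.Binary.Reasoning.Setoid as SetoidReasoning
open import Relation.Nullary using (¬_; yes; no; contradiction)
open import Relation.Nullary.Decidable using (from-yes; from-no)

-- `K` is any field of characteristic zero, with no decision procedure for equality, so no ring of
-- integers, norm or prime ideal above p is at hand. Their place is taken by multipliers: for a
-- finitely generated additive group M, S = {x | xM ⊆ M} is a commutative ring containing ℤ, and
-- reduction happens in S/pS. Here M is spanned by 1, ζ, ..., ζ^(m-1) or by θ and 1. The generators
-- may be dependent, so ζ^m = 1 suffices to make ζ a multiplier and no cyclotomic polynomial enters.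
-- S/pS may have zero divisors, so "nonzero modulo p" would not survive products; the proof carries
-- explicit inverses instead. That S/pS is not the zero ring is what Nakayama supplies: the
-- generator 1 of M turns (1 + kp)M = 0 into the integer equation 1 + kp = 0. For p = 2 and p = 3
-- every nonzero residue is its own inverse, which disposes of the coefficient a. The residues 0 and
-- 1 allowed for g(3) are the squares modulo 3; for g(3) ≡ 2 the factor is α² + 1, irreducible over
-- the field of three elements and zero at a primitive fourth root of unity.

-- The image of ℤ in a commutative ring, and a ring solver with integer coefficients

module IntegerImage {c ℓ : Level} (R : CommutativeRing c ℓ) where
  open CommutativeRing R
  open RingOps R
  open RingProperties ring using (-‿distribˡ-*; -‿distribʳ-*; -‿involutive; -0#≈0#)
  open AbelianGroupProperties +-abelianGroup using () renaming (⁻¹-∙-comm to -‿+-comm)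
  open SetoidReasoning setoid

  fromℕ-+ : ∀ m n → fromℕ (m ℕ.+ n) ≈ fromℕ m + fromℕ n
  fromℕ-+ zero    n = sym (+-identityˡ _)
  fromℕ-+ (suc m) n = trans (+-congˡ (fromℕ-+ m n)) (sym (+-assoc _ _ _))

  fromℕ-* : ∀ m n → fromℕ (m ℕ.* n) ≈ fromℕ m * fromℕ n
  fromℕ-* zero    n = sym (zeroˡ _)
  fromℕ-* (suc m) n = begin
    fromℕ (n ℕ.+ m ℕ.* n)             ≈⟨ fromℕ-+ n (m ℕ.* n) ⟩
    fromℕ n + fromℕ (m ℕ.* n)         ≈⟨ +-cong (sym (*-identityˡ _)) (fromℕ-* m n) ⟩
    1# * fromℕ n + fromℕ m * fromℕ n  ≈⟨ distribʳ _ _ _ ⟨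
    fromℕ (suc m) * fromℕ n           ∎

  fromℤ-neg : ∀ z → fromℤ (ℤ.- z) ≈ - fromℤ z
  fromℤ-neg (+ zero)  = sym -0#≈0#
  fromℤ-neg (+ suc n) = refl
  fromℤ-neg -[1+ n ]  = sym (-‿involutive _)

  fromℤ-⊖ : ∀ m n → fromℤ (m ℤ.⊖ n) ≈ fromℕ m + - fromℕ n
  fromℤ-⊖ zero zero       = sym (trans (+-identityˡ _) -0#≈0#)
  fromℤ-⊖ zero (suc n)    = sym (+-identityˡ _)
  fromℤ-⊖ (suc m) zero    = sym (trans (+-congˡ -0#≈0#) (+-identityʳ _))
  fromℤ-⊖ (suc m) (suc n) = begin
    fromℤ (suc m ℤ.⊖ suc n)                ≡⟨ ≡.cong fromℤ (ℤₚ.[1+m]⊖[1+n]≡m⊖n m n) ⟩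
    fromℤ (m ℤ.⊖ n)                        ≈⟨ fromℤ-⊖ m n ⟩
    fromℕ m + - fromℕ n                    ≈⟨ +-congʳ (+-identityˡ _) ⟨
    (0# + fromℕ m) + - fromℕ n             ≈⟨ +-congʳ (+-congʳ (-‿inverseʳ _)) ⟨
    ((1# + - 1#) + fromℕ m) + - fromℕ n    ≈⟨ +-congʳ (+-assoc _ _ _) ⟩
    (1# + (- 1# + fromℕ m)) + - fromℕ n    ≈⟨ +-congʳ (+-congˡ (+-comm _ _)) ⟩
    (1# + (fromℕ m + - 1#)) + - fromℕ n    ≈⟨ +-congʳ (+-assoc _ _ _) ⟨
    ((1# + fromℕ m) + - 1#) + - fromℕ n    ≈⟨ +-assoc _ _ _ ⟩
    (1# + fromℕ m) + (- 1# + - fromℕ n)    ≈⟨ +-congˡ (-‿+-comm _ _) ⟩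
    (1# + fromℕ m) + - (1# + fromℕ n)      ∎

  fromℤ-+ : ∀ x y → fromℤ (x ℤ.+ y) ≈ fromℤ x + fromℤ y
  fromℤ-+ (+ m)    (+ n)    = fromℕ-+ m n
  fromℤ-+ (+ m)    -[1+ n ] = fromℤ-⊖ m (suc n)
  fromℤ-+ -[1+ m ] (+ n)    = trans (fromℤ-⊖ n (suc m)) (+-comm _ _)
  fromℤ-+ -[1+ m ] -[1+ n ] = begin
    - fromℕ (suc (suc (m ℕ.+ n)))        ≡⟨ ≡.cong (λ k → - fromℕ (suc k)) (ℕₚ.+-suc m n) ⟨
    - fromℕ (suc m ℕ.+ suc n)            ≈⟨ -‿cong (fromℕ-+ (suc m) (suc n)) ⟩
    - (fromℕ (suc m) + fromℕ (suc n))    ≈⟨ -‿+-comm _ _ ⟨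
    - fromℕ (suc m) + - fromℕ (suc n)    ∎

  fromℤ-*-pos : ∀ x n → fromℤ (x ℤ.* + n) ≈ fromℤ x * fromℕ n
  fromℤ-*-pos (+ m) n = begin
    fromℤ (+ m ℤ.* + n)  ≡⟨ ≡.cong fromℤ (ℤₚ.pos-* m n) ⟨
    fromℕ (m ℕ.* n)      ≈⟨ fromℕ-* m n ⟩
    fromℕ m * fromℕ n    ∎
  fromℤ-*-pos -[1+ m ] n = begin
    fromℤ (-[1+ m ] ℤ.* + n)          ≡⟨ ≡.cong fromℤ (ℤₚ.neg-distribˡ-* (+ suc m) (+ n)) ⟨
    fromℤ (ℤ.- (+ suc m ℤ.* + n))     ≈⟨ fromℤ-neg (+ suc m ℤ.* + n) ⟩
    - fromℤ (+ suc m ℤ.* + n)         ≈⟨ -‿cong (fromℤ-*-pos (+ suc m) n) ⟩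
    - (fromℕ (suc m) * fromℕ n)       ≈⟨ -‿distribˡ-* _ _ ⟩
    - fromℕ (suc m) * fromℕ n         ∎

  fromℤ-* : ∀ x y → fromℤ (x ℤ.* y) ≈ fromℤ x * fromℤ y
  fromℤ-* x (+ n)    = fromℤ-*-pos x n
  fromℤ-* x -[1+ n ] = begin
    fromℤ (x ℤ.* -[1+ n ])           ≡⟨ ≡.cong fromℤ (ℤₚ.neg-distribʳ-* x (+ suc n)) ⟨
    fromℤ (ℤ.- (x ℤ.* + suc n))      ≈⟨ fromℤ-neg (x ℤ.* + suc n) ⟩
    - fromℤ (x ℤ.* + suc n)          ≈⟨ -‿cong (fromℤ-*-pos x (suc n)) ⟩
    - (fromℤ x * fromℕ (suc n))      ≈⟨ -‿distribʳ-* _ _ ⟩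
    fromℤ x * - fromℕ (suc n)        ∎

  fromℤ-1 : fromℤ (+ 1) ≈ 1#
  fromℤ-1 = +-identityʳ 1#

  -- Agrees with fromℤ, but sends the literals 0 and 1 to 0# and 1# on the nose.
  literal : ℤ → Carrier
  literal (+ 1) = 1#
  literal z     = fromℤ z

  literal≈fromℤ : ∀ z → literal z ≈ fromℤ z
  literal≈fromℤ (+ 0)           = refl
  literal≈fromℤ (+ 1)           = sym fromℤ-1
  literal≈fromℤ (+ suc (suc n)) = refl
  literal≈fromℤ -[1+ n ]        = refl

  literal-morphism : CommutativeRing.rawRing ℤₚ.+-*-commutativeRing
                       -Raw-AlmostCommutative⟶ fromCommutativeRing R
  literal-morphism = record
    { ⟦_⟧    = literal
    ; +-homo = λ x y → trans (literal≈fromℤ (x ℤ.+ y)) (trans (fromℤ-+ x y)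
                 (sym (+-cong (literal≈fromℤ x) (literal≈fromℤ y))))
    ; *-homo = λ x y → trans (literal≈fromℤ (x ℤ.* y)) (trans (fromℤ-* x y)
                 (sym (*-cong (literal≈fromℤ x) (literal≈fromℤ y))))
    ; -‿homo = λ x → trans (literal≈fromℤ (ℤ.- x)) (trans (fromℤ-neg x)
                 (sym (-‿cong (literal≈fromℤ x))))
    ; 0-homo = refl
    ; 1-homo = refl
    }

  literal-≟ : ∀ x y → Maybe (literal x ≈ literal y)
  literal-≟ x y with x ℤ.≟ y
  ... | yes ≡.refl = just refl
  ... | no _       = nothing

  open Algebra.Solver.Ring (CommutativeRing.rawRing ℤₚ.+-*-commutativeRing)
    (fromCommutativeRing R) literal-morphism literal-≟ public
    using (solve; _:=_; con; _:+_; _:*_; _:-_; :-_)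

-- Finite sums and exchange of summation over a triangle

module FiniteSums {c ℓ : Level} (R : CommutativeRing c ℓ) where
  open CommutativeRing R
  open RingOps R
  open CommutativeSemigroupProperties
    (CommutativeMonoid.commutativeSemigroup +-commutativeMonoid)
    using () renaming (interchange to +-interchange)
  open SetoidReasoning setoid

  sumK-cong : ∀ n {f h : ℕ → Carrier} → (∀ i → i ℕ.≤ n → f i ≈ h i) → sumK n f ≈ sumK n h
  sumK-cong zero    f≈h = f≈h 0 z≤n
  sumK-cong (suc n) f≈h =
    +-cong (sumK-cong n (λ i i≤n → f≈h i (ℕₚ.m≤n⇒m≤1+n i≤n))) (f≈h (suc n) ℕₚ.≤-refl)

  sumK-0 : ∀ n {f : ℕ → Carrier} → (∀ i → i ℕ.≤ n → f i ≈ 0#) → sumK n f ≈ 0#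
  sumK-0 zero    f≈0 = f≈0 0 z≤n
  sumK-0 (suc n) f≈0 = trans
    (+-cong (sumK-0 n (λ i i≤n → f≈0 i (ℕₚ.m≤n⇒m≤1+n i≤n))) (f≈0 (suc n) ℕₚ.≤-refl))
    (+-identityʳ 0#)

  sumK-+ : ∀ n (f h : ℕ → Carrier) → sumK n (λ i → f i + h i) ≈ sumK n f + sumK n h
  sumK-+ zero    f h = refl
  sumK-+ (suc n) f h = trans (+-congʳ (sumK-+ n f h)) (+-interchange _ _ _ _)

  sumK-*ˡ : ∀ n x (f : ℕ → Carrier) → x * sumK n f ≈ sumK n (λ i → x * f i)
  sumK-*ˡ zero    x f = refl
  sumK-*ˡ (suc n) x f = trans (distribˡ _ _ _) (+-congʳ (sumK-*ˡ n x f))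

  sumK-head : ∀ n (f : ℕ → Carrier) → sumK (suc n) f ≈ f 0 + sumK n (f ∘ suc)
  sumK-head zero    f = refl
  sumK-head (suc n) f = trans (+-congʳ (sumK-head n f)) (+-assoc _ _ _)

  sumK-extend : ∀ {m n} {f : ℕ → Carrier} → m ℕ.≤′ n →
                (∀ i → m ℕ.< i → f i ≈ 0#) → sumK n f ≈ sumK m f
  sumK-extend ℕ.≤′-refl           f≈0 = refl
  sumK-extend (ℕ.≤′-step {n} m≤n) f≈0 = trans
    (+-cong (sumK-extend m≤n f≈0) (f≈0 (suc n) (s≤s (ℕₚ.≤′⇒≤ m≤n))))
    (+-identityʳ _)

  sumK-swap : ∀ m n (f : ℕ → ℕ → Carrier) →
              sumK m (λ i → sumK n (f i)) ≈ sumK n (λ j → sumK m (λ i → f i j))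
  sumK-swap zero    n f = refl
  sumK-swap (suc m) n f = trans (+-congʳ (sumK-swap m n f)) (sym (sumK-+ n _ _))

  sumK-reverse : ∀ n (f : ℕ → Carrier) → sumK n (λ i → f (n ∸ i)) ≈ sumK n f
  sumK-reverse zero    f = refl
  sumK-reverse (suc n) f = begin
    sumK (suc n) (λ i → f (suc n ∸ i))       ≈⟨ sumK-head n _ ⟩
    f (suc n) + sumK n (λ i → f (n ∸ i))     ≈⟨ +-congˡ (sumK-reverse n f) ⟩
    f (suc n) + sumK n f                     ≈⟨ +-comm _ _ ⟩
    sumK n f + f (suc n)                     ∎

  -- Enlarging the triangle i + j ≤ n to i + j ≤ n + 1 adds exactly the diagonal i + j = n + 1.
  -- Growing by diagonals treats both indices alike, so `sumK-triangle-swap` only has to reverse one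
  -- diagonal per step.
  sumK-triangle-diagonal : ∀ n (f : ℕ → ℕ → Carrier) →
    sumK (suc n) (λ i → sumK (suc n ∸ i) (f i)) ≈
    sumK n (λ i → sumK (n ∸ i) (f i)) + sumK (suc n) (λ i → f i (suc n ∸ i))
  sumK-triangle-diagonal n f = begin
    sumK n (λ i → sumK (suc n ∸ i) (f i)) + sumK (n ∸ n) (f (suc n))
      ≈⟨ +-cong (sumK-cong n last-term) (reflexive last-row) ⟩
    sumK n (λ i → sumK (n ∸ i) (f i) + f i (suc n ∸ i)) + f (suc n) (n ∸ n)
      ≈⟨ +-congʳ (sumK-+ n _ _) ⟩
    (sumK n (λ i → sumK (n ∸ i) (f i)) + sumK n (λ i → f i (suc n ∸ i))) + f (suc n) (n ∸ n)
      ≈⟨ +-assoc _ _ _ ⟩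
    sumK n (λ i → sumK (n ∸ i) (f i)) + sumK (suc n) (λ i → f i (suc n ∸ i)) ∎
    where
    last-term : ∀ i → i ℕ.≤ n →
                sumK (suc n ∸ i) (f i) ≈ sumK (n ∸ i) (f i) + f i (suc n ∸ i)
    last-term i i≤n rewrite ℕₚ.+-∸-assoc 1 i≤n = refl
    last-row : sumK (n ∸ n) (f (suc n)) ≡ f (suc n) (n ∸ n)
    last-row rewrite ℕₚ.n∸n≡0 n = ≡.refl

  sumK-triangle-swap : ∀ n (f : ℕ → ℕ → Carrier) →
    sumK n (λ i → sumK (n ∸ i) (f i)) ≈ sumK n (λ j → sumK (n ∸ j) (λ i → f i j))
  sumK-triangle-swap zero    f = refl
  sumK-triangle-swap (suc n) f = begin
    sumK (suc n) (λ i → sumK (suc n ∸ i) (f i))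
      ≈⟨ sumK-triangle-diagonal n f ⟩
    sumK n (λ i → sumK (n ∸ i) (f i)) + sumK (suc n) (λ i → f i (suc n ∸ i))
      ≈⟨ +-cong (sumK-triangle-swap n f) diagonal-swap ⟩
    sumK n (λ j → sumK (n ∸ j) (λ i → f i j)) + sumK (suc n) (λ j → f (suc n ∸ j) j)
      ≈⟨ sumK-triangle-diagonal n (λ j i → f i j) ⟨
    sumK (suc n) (λ j → sumK (suc n ∸ j) (λ i → f i j)) ∎
    where
    diagonal-swap : sumK (suc n) (λ i → f i (suc n ∸ i)) ≈ sumK (suc n) (λ j → f (suc n ∸ j) j)
    diagonal-swap = begin
      sumK (suc n) (λ i → f i (suc n ∸ i))
        ≈⟨ sumK-cong (suc n) (λ i i≤n → reflexive (≡.cong (λ k → f k (suc n ∸ i)) (ℕₚ.m∸[m∸n]≡n i≤n))) ⟨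
      sumK (suc n) (λ i → f (suc n ∸ (suc n ∸ i)) (suc n ∸ i))
        ≈⟨ sumK-reverse (suc n) (λ j → f (suc n ∸ j) j) ⟩
      sumK (suc n) (λ j → f (suc n ∸ j) j) ∎

-- Formal power series, the derivation q d/dq and the exponential

module FormalSeries {c ℓ : Level} (R : CommutativeRing c ℓ) where
  open CommutativeRing R
  open RingOps R
  open IntegerImage R
  open FiniteSums R
  open CommutativeSemigroupProperties
    (CommutativeMonoid.commutativeSemigroup *-commutativeMonoid)
    using (x∙yz≈y∙xz)
  open SetoidReasoning setoid

  Series : Set c
  Series = ℕ → Carrier

  infixl 7 _⊛_
  _⊛_ : Series → Series → Series
  (F ⊛ H) n = sumK n (λ i → F i * H (n ∸ i))

  one : Series
  one zero    = 1#
  one (suc _) = 0#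

  pow : Series → ℕ → Series
  pow F zero    = one
  pow F (suc k) = F ⊛ pow F k

  -- The derivation q d/dq.
  ϑ : Series → Series
  ϑ F n = fromℕ n * F n

  ⊛-congˡ : ∀ F {H H′ : Series} → (∀ n → H n ≈ H′ n) → ∀ n → (F ⊛ H) n ≈ (F ⊛ H′) n
  ⊛-congˡ F H≈H′ n = sumK-cong n (λ i _ → *-congˡ (H≈H′ (n ∸ i)))

  ⊛-scaleʳ : ∀ x F H n → (F ⊛ (λ k → x * H k)) n ≈ x * (F ⊛ H) n
  ⊛-scaleʳ x F H n = trans (sumK-cong n (λ i _ → x∙yz≈y∙xz _ _ _)) (sym (sumK-*ˡ n x _))

  -- Associativity and commutativity of the Cauchy product in the single combination that the power
  -- rule needs: it moves `F` past `ϑ F`.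
  ⊛-left-comm : ∀ F H L n → (F ⊛ (H ⊛ L)) n ≈ (H ⊛ (F ⊛ L)) n
  ⊛-left-comm F H L n = begin
    sumK n (λ i → F i * sumK (n ∸ i) (λ j → H j * L (n ∸ i ∸ j)))
      ≈⟨ sumK-cong n (λ i _ → sumK-*ˡ (n ∸ i) _ _) ⟩
    sumK n (λ i → sumK (n ∸ i) (λ j → F i * (H j * L (n ∸ i ∸ j))))
      ≈⟨ sumK-triangle-swap n _ ⟩
    sumK n (λ j → sumK (n ∸ j) (λ i → F i * (H j * L (n ∸ i ∸ j))))
      ≈⟨ sumK-cong n (λ j _ → sumK-cong (n ∸ j) (λ i _ → trans (x∙yz≈y∙xz _ _ _)
           (*-congˡ (*-congˡ (reflexive (≡.cong L (∸-right-comm i j))))))) ⟩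
    sumK n (λ j → sumK (n ∸ j) (λ i → H j * (F i * L (n ∸ j ∸ i))))
      ≈⟨ sumK-cong n (λ j _ → sumK-*ˡ (n ∸ j) _ _) ⟨
    sumK n (λ j → H j * sumK (n ∸ j) (λ i → F i * L (n ∸ j ∸ i))) ∎
    where
    ∸-right-comm : ∀ i j → n ∸ i ∸ j ≡ n ∸ j ∸ i
    ∸-right-comm i j = ≡.trans (ℕₚ.∸-+-assoc n i j)
      (≡.trans (≡.cong (n ∸_) (ℕₚ.+-comm i j)) (≡.sym (ℕₚ.∸-+-assoc n j i)))

  -- The Leibniz rule, from n = i + (n - i) in each term of the convolution.
  ϑ-⊛ : ∀ F H n → ϑ (F ⊛ H) n ≈ (ϑ F ⊛ H) n + (F ⊛ ϑ H) n
  ϑ-⊛ F H n = begin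
    fromℕ n * sumK n (λ i → F i * H (n ∸ i))
      ≈⟨ sumK-*ˡ n _ _ ⟩
    sumK n (λ i → fromℕ n * (F i * H (n ∸ i)))
      ≈⟨ sumK-cong n (λ i i≤n → trans (*-congʳ (split i i≤n))
           (solve 4 (λ a b x y → (a :+ b) :* (x :* y) := a :* x :* y :+ x :* (b :* y))
              refl (fromℕ i) (fromℕ (n ∸ i)) (F i) (H (n ∸ i)))) ⟩
    sumK n (λ i → ϑ F i * H (n ∸ i) + F i * ϑ H (n ∸ i))
      ≈⟨ sumK-+ n _ _ ⟩
    (ϑ F ⊛ H) n + (F ⊛ ϑ H) n ∎
    where
    split : ∀ i → i ℕ.≤ n → fromℕ n ≈ fromℕ i + fromℕ (n ∸ i)
    split i i≤n = trans (reflexive (≡.cong fromℕ (≡.sym (ℕₚ.m+[n∸m]≡n i≤n)))) (fromℕ-+ i (n ∸ i))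

  ϑ-pow : ∀ F k n → ϑ (pow F (suc k)) n ≈ fromℕ (suc k) * (ϑ F ⊛ pow F k) n
  ϑ-pow F zero n = begin
    ϑ (F ⊛ one) n                        ≈⟨ ϑ-⊛ F one n ⟩
    (ϑ F ⊛ one) n + (F ⊛ ϑ one) n        ≈⟨ +-congˡ (sumK-0 n (λ i _ → trans (*-congˡ (ϑ-one (n ∸ i))) (zeroʳ _))) ⟩
    (ϑ F ⊛ one) n + 0#                   ≈⟨ +-identityʳ _ ⟩
    (ϑ F ⊛ one) n                        ≈⟨ *-identityˡ _ ⟨
    1# * (ϑ F ⊛ one) n                   ≈⟨ *-congʳ (+-identityʳ 1#) ⟨
    fromℕ 1 * (ϑ F ⊛ one) n              ∎
    where
    ϑ-one : ∀ n → ϑ one n ≈ 0#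
    ϑ-one zero    = zeroˡ _
    ϑ-one (suc n) = zeroʳ _
  ϑ-pow F (suc k) n = begin
    ϑ (F ⊛ pow F (suc k)) n
      ≈⟨ ϑ-⊛ F (pow F (suc k)) n ⟩
    X + (F ⊛ ϑ (pow F (suc k))) n
      ≈⟨ +-congˡ (⊛-congˡ F (ϑ-pow F k) n) ⟩
    X + (F ⊛ (λ m → fromℕ (suc k) * (ϑ F ⊛ pow F k) m)) n
      ≈⟨ +-congˡ (⊛-scaleʳ (fromℕ (suc k)) F (ϑ F ⊛ pow F k) n) ⟩
    X + fromℕ (suc k) * (F ⊛ (ϑ F ⊛ pow F k)) n
      ≈⟨ +-cong (sym (*-identityˡ X)) (*-congˡ (⊛-left-comm F (ϑ F) (pow F k) n)) ⟩
    1# * X + fromℕ (suc k) * X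
      ≈⟨ distribʳ _ _ _ ⟨
    fromℕ (suc (suc k)) * X ∎
    where X = (ϑ F ⊛ pow F (suc k)) n

  ⊛-shift : ∀ F H n → F 0 ≈ 0# → (F ⊛ H) (suc n) ≈ sumK n (λ j → F (suc j) * H (n ∸ j))
  ⊛-shift F H n F₀≈0 = begin
    (F ⊛ H) (suc n)                  ≈⟨ sumK-head n _ ⟩
    F 0 * H (suc n) + Σ              ≈⟨ +-congʳ (trans (*-congʳ F₀≈0) (zeroˡ _)) ⟩
    0# + Σ                           ≈⟨ +-identityˡ _ ⟩
    Σ                                ∎
    where Σ = sumK n (λ j → F (suc j) * H (n ∸ j))

  -- Each factor `F` contributes at least one power of q. This is what makes every coefficient of
  -- exp (x F) a polynomial in x.
  pow-order : ∀ F → F 0 ≈ 0# → ∀ {n k} → n ℕ.< k → pow F k n ≈ 0#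
  pow-order F F₀≈0 {zero}  {suc k} _         = trans (*-congʳ F₀≈0) (zeroˡ _)
  pow-order F F₀≈0 {suc n} {suc k} (s≤s n<k) = trans (⊛-shift F (pow F k) n F₀≈0)
    (sumK-0 n (λ j _ → trans
      (*-congˡ (pow-order F F₀≈0 (ℕₚ.≤-<-trans (ℕₚ.m∸n≤m n j) n<k))) (zeroʳ _)))

  -- For w k = 1/k! this is the coefficient of qⁿ in exp (x F).
  expCoeff : Series → (ℕ → Carrier) → ℕ → Carrier → Carrier
  expCoeff F w n x = sumK n (λ k → pow F k n * w k * x ^ k)

  -- q d/dq exp (x F) = x (q F′) exp (x F)
  expCoeff-rec : ∀ F w → F 0 ≈ 0# → (∀ k → fromℕ (suc k) * w (suc k) ≈ w k) → ∀ n x →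
    fromℕ (suc n) * expCoeff F w (suc n) x ≈
    x * sumK n (λ j → ϑ F (suc j) * expCoeff F w (n ∸ j) x)
  expCoeff-rec F w F₀≈0 w-rec n x = begin
    fromℕ (suc n) * expCoeff F w (suc n) x
      -- The k = 0 summand is split off: F⁰ = 1 has no term in q^(n+1), and the remaining summands
      -- all carry a factor x.
      ≈⟨ *-congˡ (sumK-head n _) ⟩
    fromℕ (suc n) * (0# * w 0 * 1# + sumK n (λ k → pow F (suc k) (suc n) * w (suc k) * x ^ suc k))
      ≈⟨ *-congˡ (trans (+-congʳ (trans (*-congʳ (zeroˡ _)) (zeroˡ _))) (+-identityˡ _)) ⟩
    fromℕ (suc n) * sumK n (λ k → pow F (suc k) (suc n) * w (suc k) * x ^ suc k)
      ≈⟨ sumK-*ˡ n _ _ ⟩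
    sumK n (λ k → fromℕ (suc n) * (pow F (suc k) (suc n) * w (suc k) * x ^ suc k))
      ≈⟨ sumK-cong n (λ k _ → coefficient k) ⟩
    sumK n (λ k → sumK n (λ j → x * (ϑ F (suc j) * (pow F k (n ∸ j) * w k * x ^ k))))
      ≈⟨ sumK-swap n n _ ⟩
    sumK n (λ j → sumK n (λ k → x * (ϑ F (suc j) * (pow F k (n ∸ j) * w k * x ^ k))))
      ≈⟨ sumK-cong n (λ j _ → trans (*-congˡ (sumK-*ˡ n _ _)) (sumK-*ˡ n _ _)) ⟨
    sumK n (λ j → x * (ϑ F (suc j) * sumK n (λ k → pow F k (n ∸ j) * w k * x ^ k)))
      ≈⟨ sumK-cong n (λ j _ → *-congˡ (*-congˡ (truncate j))) ⟩
    sumK n (λ j → x * (ϑ F (suc j) * expCoeff F w (n ∸ j) x))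
      ≈⟨ sumK-*ˡ n x _ ⟨
    x * sumK n (λ j → ϑ F (suc j) * expCoeff F w (n ∸ j) x) ∎
    where
    -- After the exchange of sums k still runs up to n, whereas the coefficient at q^(n-j) stops at
    -- n - j; the surplus powers of `F` have too high an order to contribute.
    truncate : ∀ j → sumK n (λ k → pow F k (n ∸ j) * w k * x ^ k) ≈ expCoeff F w (n ∸ j) x
    truncate j = sumK-extend (ℕₚ.≤⇒≤′ (ℕₚ.m∸n≤m n j)) (λ k n∸j<k →
      trans (*-congʳ (trans (*-congʳ (pow-order F F₀≈0 n∸j<k)) (zeroˡ _))) (zeroˡ _))

    -- The factor n + 1 is absorbed into `ϑ`; the power rule then produces a factor k + 1, which
    -- `w-rec` cancels against the weight.
    coefficient : ∀ k →
      fromℕ (suc n) * (pow F (suc k) (suc n) * w (suc k) * x ^ suc k) ≈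
      sumK n (λ j → x * (ϑ F (suc j) * (pow F k (n ∸ j) * w k * x ^ k)))
    coefficient k = begin
      fromℕ (suc n) * (pow F (suc k) (suc n) * w (suc k) * (x * x ^ k))
        ≈⟨ solve 5 (λ a b c d e → a :* (b :* c :* (d :* e)) := a :* b :* c :* d :* e) refl _ _ _ _ _ ⟩
      ϑ (pow F (suc k)) (suc n) * w (suc k) * x * x ^ k
        ≈⟨ *-congʳ (*-congʳ (*-congʳ (trans (ϑ-pow F k (suc n))
             (*-congˡ (⊛-shift (ϑ F) (pow F k) n (zeroˡ _)))))) ⟩
      fromℕ (suc k) * Σ * w (suc k) * x * x ^ k
        ≈⟨ solve 5 (λ a b c d e → a :* b :* c :* d :* e := (a :* c) :* d :* e :* b) refl _ _ _ _ _ ⟩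
      fromℕ (suc k) * w (suc k) * x * x ^ k * Σ
        ≈⟨ *-congʳ (*-congʳ (*-congʳ (w-rec k))) ⟩
      w k * x * x ^ k * Σ
        ≈⟨ sumK-*ˡ n _ _ ⟩
      sumK n (λ j → w k * x * x ^ k * (ϑ F (suc j) * pow F k (n ∸ j)))
        ≈⟨ sumK-cong n (λ j _ → solve 5 (λ a b c d e →
             a :* b :* c :* (d :* e) := b :* (d :* (e :* a :* c))) refl _ _ _ _ _) ⟩
      sumK n (λ j → x * (ϑ F (suc j) * (pow F k (n ∸ j) * w k * x ^ k))) ∎
      where Σ = sumK n (λ j → ϑ F (suc j) * pow F k (n ∸ j))

-- Rational coefficients in K and the recurrence for n! P_n(α)

module CharZero {c ℓ : Level} (K : CharZeroField c ℓ) where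
  open CharZeroField K
  open FieldOps K
  open IntegerImage cring
  open FiniteSums cring
  open FormalSeries cring
  open SetoidReasoning setoid

  *-cancelʳ : ∀ {z} → ¬ (z ≈ 0#) → ∀ {x y} → x * z ≈ y * z → x ≈ y
  *-cancelʳ {z} z≉0 {x} {y} xz≈yz = begin
    x                ≈⟨ *-identityʳ x ⟨
    x * 1#           ≈⟨ *-congˡ (inverseʳ z z≉0) ⟨
    x * (z * z ⁻¹)   ≈⟨ *-assoc x z _ ⟨
    x * z * z ⁻¹     ≈⟨ *-congʳ xz≈yz ⟩
    y * z * z ⁻¹     ≈⟨ *-assoc y z _ ⟩
    y * (z * z ⁻¹)   ≈⟨ *-congˡ (inverseʳ z z≉0) ⟩
    y * 1#           ≈⟨ *-identityʳ y ⟩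
    y                ∎

  *-≉0 : ∀ {x y} → ¬ (x ≈ 0#) → ¬ (y ≈ 0#) → ¬ (x * y ≈ 0#)
  *-≉0 {x} {y} x≉0 y≉0 xy≈0 = x≉0 (*-cancelʳ y≉0 (trans xy≈0 (sym (zeroˡ y))))

  fromℚ-spec : ∀ q → fromℚ q * fromℤ (↧ q) ≈ fromℤ (↥ q)
  fromℚ-spec q@record{} = begin
    fromℤ (↥ q) * d ⁻¹ * d    ≈⟨ *-assoc _ _ _ ⟩
    fromℤ (↥ q) * (d ⁻¹ * d)  ≈⟨ *-congˡ (trans (*-comm _ _) (inverseʳ d (charZero (ℚ.denominator-1 q)))) ⟩
    fromℤ (↥ q) * 1#          ≈⟨ *-identityʳ _ ⟩
    fromℤ (↥ q)               ∎
    where d = fromℤ (↧ q)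

  -- Rational operations reduce their result by a gcd, which hides numerator and denominator.
  -- Comparison with an unnormalised representative `u` gives access to the textbook fractions for
  -- sums and products.
  fromℚ-≃ : ∀ q u → toℚᵘ q ℚᵘ.≃ u → fromℚ q * fromℤ (ℚᵘ.↧ u) ≈ fromℤ (ℚᵘ.↥ u)
  fromℚ-≃ q@record{} u (ℚᵘ.*≡* eq) = *-cancelʳ (charZero (ℚ.denominator-1 q)) (begin
    fromℚ q * fromℤ (ℚᵘ.↧ u) * fromℤ (↧ q)
      ≈⟨ solve 3 (λ a b c → a :* b :* c := a :* c :* b) refl _ _ _ ⟩
    fromℚ q * fromℤ (↧ q) * fromℤ (ℚᵘ.↧ u)
      ≈⟨ *-congʳ (fromℚ-spec q) ⟩
    fromℤ (↥ q) * fromℤ (ℚᵘ.↧ u)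
      ≈⟨ fromℤ-* (↥ q) (ℚᵘ.↧ u) ⟨
    fromℤ (↥ q ℤ.* ℚᵘ.↧ u)
      ≡⟨ ≡.cong fromℤ eq ⟩
    fromℤ (ℚᵘ.↥ u ℤ.* ↧ q)
      ≈⟨ fromℤ-* (ℚᵘ.↥ u) (↧ q) ⟩
    fromℤ (ℚᵘ.↥ u) * fromℤ (↧ q) ∎)

  fromℚ-/ : ∀ z n .{{_ : ℕ.NonZero n}} → fromℚ (z ℚ./ n) * fromℕ n ≈ fromℤ z
  fromℚ-/ z n@(suc d) = fromℚ-≃ (z ℚ./ n) (mkℚᵘ z d) (ℚₚ.toℚᵘ-fromℚᵘ (mkℚᵘ z d))

  fromℚ-+ : ∀ p q → fromℚ (p ℚ.+ q) ≈ fromℚ p + fromℚ q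
  fromℚ-+ p@record{} q@record{} =
    *-cancelʳ (*-≉0 (charZero (ℚ.denominator-1 p)) (charZero (ℚ.denominator-1 q))) (begin
    fromℚ (p ℚ.+ q) * (P * Q)
      ≈⟨ *-congˡ (fromℤ-* (↧ p) (↧ q)) ⟨
    fromℚ (p ℚ.+ q) * fromℤ (↧ p ℤ.* ↧ q)
      ≈⟨ fromℚ-≃ (p ℚ.+ q) (toℚᵘ p ℚᵘ.+ toℚᵘ q) (ℚₚ.toℚᵘ-homo-+ p q) ⟩
    fromℤ (↥ p ℤ.* ↧ q ℤ.+ ↥ q ℤ.* ↧ p)
      ≈⟨ fromℤ-+ (↥ p ℤ.* ↧ q) (↥ q ℤ.* ↧ p) ⟩
    fromℤ (↥ p ℤ.* ↧ q) + fromℤ (↥ q ℤ.* ↧ p)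
      ≈⟨ +-cong (fromℤ-* (↥ p) (↧ q)) (fromℤ-* (↥ q) (↧ p)) ⟩
    fromℤ (↥ p) * Q + fromℤ (↥ q) * P
      ≈⟨ +-cong (*-congʳ (fromℚ-spec p)) (*-congʳ (fromℚ-spec q)) ⟨
    fromℚ p * P * Q + fromℚ q * Q * P
      ≈⟨ solve 4 (λ x y a b → x :* a :* b :+ y :* b :* a := (x :+ y) :* (a :* b)) refl _ _ _ _ ⟩
    (fromℚ p + fromℚ q) * (P * Q) ∎)
    where
    P = fromℤ (↧ p)
    Q = fromℤ (↧ q)

  fromℚ-* : ∀ p q → fromℚ (p ℚ.* q) ≈ fromℚ p * fromℚ q
  fromℚ-* p@record{} q@record{} =
    *-cancelʳ (*-≉0 (charZero (ℚ.denominator-1 p)) (charZero (ℚ.denominator-1 q))) (begin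
    fromℚ (p ℚ.* q) * (P * Q)
      ≈⟨ *-congˡ (fromℤ-* (↧ p) (↧ q)) ⟨
    fromℚ (p ℚ.* q) * fromℤ (↧ p ℤ.* ↧ q)
      ≈⟨ fromℚ-≃ (p ℚ.* q) (toℚᵘ p ℚᵘ.* toℚᵘ q) (ℚₚ.toℚᵘ-homo-* p q) ⟩
    fromℤ (↥ p ℤ.* ↥ q)
      ≈⟨ fromℤ-* (↥ p) (↥ q) ⟩
    fromℤ (↥ p) * fromℤ (↥ q)
      ≈⟨ *-cong (fromℚ-spec p) (fromℚ-spec q) ⟨
    (fromℚ p * P) * (fromℚ q * Q)
      ≈⟨ solve 4 (λ x y a b → (x :* a) :* (y :* b) := (x :* y) :* (a :* b)) refl _ _ _ _ ⟩
    (fromℚ p * fromℚ q) * (P * Q) ∎)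
    where
    P = fromℤ (↧ p)
    Q = fromℤ (↧ q)

  fromℚ-0 : fromℚ ℚ.0ℚ ≈ 0#
  fromℚ-0 = zeroˡ _

  fromℚ-1 : fromℚ ℚ.1ℚ ≈ 1#
  fromℚ-1 = inverseʳ (fromℕ 1) (charZero 0)

  fromℚ-sumℚ : ∀ n f → fromℚ (sumℚ n f) ≈ sumK n (fromℚ ∘ f)
  fromℚ-sumℚ zero    f = refl
  fromℚ-sumℚ (suc n) f = trans (fromℚ-+ (sumℚ n f) (f (suc n))) (+-congʳ (fromℚ-sumℚ n f))

  fromℚ-^ₚ : ∀ F k n → fromℚ ((F ^ₚ k) n) ≈ pow (fromℚ ∘ F) k n
  fromℚ-^ₚ F zero zero    = fromℚ-1
  fromℚ-^ₚ F zero (suc n) = fromℚ-0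
  fromℚ-^ₚ F (suc k) n    = trans (fromℚ-sumℚ n _) (sumK-cong n (λ i _ →
    trans (fromℚ-* (F i) ((F ^ₚ k) (n ∸ i))) (*-congˡ (fromℚ-^ₚ F k (n ∸ i)))))

  1/_! : ℕ → Carrier
  1/ k ! = fromℚ ((ℤ.1ℤ ℚ./ (k !)) {{k ℕₚ.!≢0}})

  1/!-spec : ∀ k → 1/ k ! * fromℕ (k !) ≈ 1#
  1/!-spec k = trans (fromℚ-/ ℤ.1ℤ (k !) {{k ℕₚ.!≢0}}) fromℤ-1

  fromℕ-!≉0 : ∀ k → ¬ (fromℕ (k !) ≈ 0#)
  fromℕ-!≉0 k k!≈0 = 1≉0 (trans (sym (1/!-spec k)) (trans (*-congˡ k!≈0) (zeroʳ _)))

  1/!-rec : ∀ k → fromℕ (suc k) * 1/ suc k ! ≈ 1/ k !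
  1/!-rec k = *-cancelʳ (fromℕ-!≉0 k) (begin
    fromℕ (suc k) * 1/ suc k ! * fromℕ (k !)
      ≈⟨ solve 3 (λ a b c → a :* b :* c := b :* (a :* c)) refl _ _ _ ⟩
    1/ suc k ! * (fromℕ (suc k) * fromℕ (k !))
      ≈⟨ *-congˡ (fromℕ-* (suc k) (k !)) ⟨
    1/ suc k ! * fromℕ (suc k !)
      ≈⟨ 1/!-spec (suc k) ⟩
    1#
      ≈⟨ 1/!-spec k ⟨
    1/ k ! * fromℕ (k !) ∎)

  evalP≈expCoeff : ∀ g n α → evalP g n α ≈ expCoeff (fromℚ ∘ Gseries g) 1/_! n α
  evalP≈expCoeff g n α = sumK-cong n (λ k _ → *-congʳ
    (trans (fromℚ-* ((Gseries g ^ₚ k) n) ((ℤ.1ℤ ℚ./ (k !)) {{k ℕₚ.!≢0}}))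
      (*-congʳ (fromℚ-^ₚ (Gseries g) k n))))

  -- The derivation undoes the division by n in g(n)/n, so the coefficients of the recurrence are
  -- integers.
  ϑ-Gseries : ∀ g j → ϑ (fromℚ ∘ Gseries g) (suc j) ≈ fromℤ (g (suc j))
  ϑ-Gseries g j = trans (*-comm _ _) (fromℚ-/ (g (suc j)) (suc j))

  evalP-rec : ∀ g n α →
    fromℕ (suc n) * evalP g (suc n) α ≈ α * sumK n (λ j → fromℤ (g (suc j)) * evalP g (n ∸ j) α)
  evalP-rec g n α = begin
    fromℕ (suc n) * evalP g (suc n) α
      ≈⟨ *-congˡ (evalP≈expCoeff g (suc n) α) ⟩
    fromℕ (suc n) * expCoeff (fromℚ ∘ Gseries g) 1/_! (suc n) α
      ≈⟨ expCoeff-rec (fromℚ ∘ Gseries g) 1/_! fromℚ-0 1/!-rec n α ⟩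
    α * sumK n (λ j → ϑ (fromℚ ∘ Gseries g) (suc j) * expCoeff (fromℚ ∘ Gseries g) 1/_! (n ∸ j) α)
      ≈⟨ *-congˡ (sumK-cong n (λ j _ →
           *-cong (ϑ-Gseries g j) (sym (evalP≈expCoeff g (n ∸ j) α)))) ⟩
    α * sumK n (λ j → fromℤ (g (suc j)) * evalP g (n ∸ j) α) ∎

  evalP-0 : ∀ g α → evalP g 0 α ≈ 1#
  evalP-0 g α = trans (*-identityʳ _) fromℚ-1

  scaledP : (ℕ → ℤ) → Carrier → ℕ → Carrier
  scaledP g α n = fromℕ (n !) * evalP g n α

  scaledP-0 : ∀ g α → scaledP g α 0 ≈ 1#
  scaledP-0 g α = trans (*-cong (+-identityʳ 1#) (evalP-0 g α)) (*-identityʳ 1#)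

  -- Source of the weights in `scaledP-rec`: scaling by factorials multiplies the j-th term by
  -- n!/(n-j)!, which is here recognised as an integer without dividing.
  P′-! : ∀ n j → j ℕ.≤ n → (n P′ j) ℕ.* (n ∸ j) ! ≡ n !
  P′-! n zero    _   = ℕₚ.*-identityˡ (n !)
  P′-! n (suc j) j<n = ≡.trans step (P′-! n j (ℕₚ.<⇒≤ j<n))
    where
    step : (n ∸ j) ℕ.* (n P′ j) ℕ.* (n ∸ suc j) ! ≡ (n P′ j) ℕ.* (n ∸ j) !
    step rewrite ≡.sym (ℕₚ.suc-pred (n ∸ j) {{ℕ.>-nonZero (ℕₚ.m<n⇒0<n∸m j<n)}})
               | ℕₚ.pred[m∸n]≡m∸[1+n] n j =
      ≡.trans (≡.cong (ℕ._* (n ∸ suc j) !) (ℕₚ.*-comm (suc (n ∸ suc j)) (n P′ j)))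
              (ℕₚ.*-assoc (n P′ j) _ _)

  scaledP-rec : ∀ g α n → scaledP g α (suc n) ≈
    α * sumK n (λ j → fromℤ (g (suc j)) * fromℕ (n P′ j) * scaledP g α (n ∸ j))
  scaledP-rec g α n = begin
    fromℕ (suc n !) * evalP g (suc n) α
      ≈⟨ *-congʳ (fromℕ-* (suc n) (n !)) ⟩
    fromℕ (suc n) * fromℕ (n !) * evalP g (suc n) α
      ≈⟨ solve 3 (λ a b c → a :* b :* c := b :* (a :* c)) refl _ _ _ ⟩
    fromℕ (n !) * (fromℕ (suc n) * evalP g (suc n) α)
      ≈⟨ *-congˡ (evalP-rec g n α) ⟩
    fromℕ (n !) * (α * sumK n (λ j → fromℤ (g (suc j)) * evalP g (n ∸ j) α))
      ≈⟨ solve 3 (λ a b c → a :* (b :* c) := b :* (a :* c)) refl _ _ _ ⟩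
    α * (fromℕ (n !) * sumK n (λ j → fromℤ (g (suc j)) * evalP g (n ∸ j) α))
      ≈⟨ *-congˡ (trans (sumK-*ˡ n _ _) (sumK-cong n distribute)) ⟩
    α * sumK n (λ j → fromℤ (g (suc j)) * fromℕ (n P′ j) * scaledP g α (n ∸ j)) ∎
    where
    distribute : ∀ j → j ℕ.≤ n → fromℕ (n !) * (fromℤ (g (suc j)) * evalP g (n ∸ j) α) ≈
                 fromℤ (g (suc j)) * fromℕ (n P′ j) * scaledP g α (n ∸ j)
    distribute j j≤n = begin
      fromℕ (n !) * (fromℤ (g (suc j)) * evalP g (n ∸ j) α)
        ≡⟨ ≡.cong (λ k → fromℕ k * (fromℤ (g (suc j)) * evalP g (n ∸ j) α)) (P′-! n j j≤n) ⟨
      fromℕ ((n P′ j) ℕ.* (n ∸ j) !) * (fromℤ (g (suc j)) * evalP g (n ∸ j) α)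
        ≈⟨ *-congʳ (fromℕ-* (n P′ j) ((n ∸ j) !)) ⟩
      fromℕ (n P′ j) * fromℕ ((n ∸ j) !) * (fromℤ (g (suc j)) * evalP g (n ∸ j) α)
        ≈⟨ solve 4 (λ a b c d → a :* b :* (c :* d) := c :* a :* (b :* d)) refl _ _ _ _ ⟩
      fromℤ (g (suc j)) * fromℕ (n P′ j) * scaledP g α (n ∸ j) ∎

-- Units of a commutative ring

module Units {c ℓ : Level} (R : CommutativeRing c ℓ) where
  open CommutativeRing R
  open IntegerImage R
  open SetoidReasoning setoid

  Unit : Carrier → Set (c ⊔ ℓ)
  Unit x = ∃[ y ] (x * y ≈ 1#)

  unit-cong : ∀ {x y} → x ≈ y → Unit x → Unit y
  unit-cong x≈y (z , xz≈1) = z , trans (*-congʳ (sym x≈y)) xz≈1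

  unit-1 : Unit 1#
  unit-1 = 1# , *-identityˡ 1#

  unit-* : ∀ {x y} → Unit x → Unit y → Unit (x * y)
  unit-* {x} {y} (z , xz≈1) (w , yw≈1) = z * w , (begin
    x * y * (z * w)    ≈⟨ solve 4 (λ x y z w → x :* y :* (z :* w) := x :* z :* (y :* w)) refl x y z w ⟩
    x * z * (y * w)    ≈⟨ *-cong xz≈1 yw≈1 ⟩
    1# * 1#            ≈⟨ *-identityˡ 1# ⟩
    1#                 ∎)

  unit-factorˡ : ∀ {x y} → Unit (x * y) → Unit x
  unit-factorˡ {x} {y} (z , xyz≈1) = y * z , trans (sym (*-assoc x y z)) xyz≈1

-- The recurrence in characteristic 2 and 3

module SmallCharacteristic {c ℓ : Level} (R : CommutativeRing c ℓ) where
  open CommutativeRing R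
  open RingOps R
  open IntegerImage R
  open FiniteSums R
  open Units R
  open SetoidReasoning setoid

  P′-vanish : ∀ {n j} → n ℕ.< j → n P′ j ≡ 0
  P′-vanish {n} {suc j} (s≤s n≤j) rewrite ℕₚ.m≤n⇒m∸n≡0 n≤j = ≡.refl

  -- A longer falling factorial is a multiple of a shorter one, so vanishing in the ring is
  -- inherited.
  P′-annihilated : ∀ n {i j} → i ℕ.≤′ j → fromℕ (n P′ i) ≈ 0# → fromℕ (n P′ j) ≈ 0#
  P′-annihilated n ℕ.≤′-refl           eq = eq
  P′-annihilated n (ℕ.≤′-step {j} i≤j) eq =
    trans (fromℕ-* (n ∸ j) (n P′ j)) (trans (*-congˡ (P′-annihilated n i≤j eq)) (zeroʳ _))

  fromℕ-+-multiple : ∀ {p} → fromℕ p ≈ 0# → ∀ r q → fromℕ (r ℕ.+ q ℕ.* p) ≈ fromℕ r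
  fromℕ-+-multiple {p} p≈0 r q = begin
    fromℕ (r ℕ.+ q ℕ.* p)          ≈⟨ fromℕ-+ r (q ℕ.* p) ⟩
    fromℕ r + fromℕ (q ℕ.* p)      ≈⟨ +-congˡ (fromℕ-* q p) ⟩
    fromℕ r + fromℕ q * fromℕ p    ≈⟨ +-congˡ (trans (*-congˡ p≈0) (zeroʳ _)) ⟩
    fromℕ r + 0#                   ≈⟨ +-identityʳ _ ⟩
    fromℕ r                        ∎

  -- `γ j` stands for g(j+1): the index is shifted, so `γ 1` is g(2) and `γ 2` is g(3).
  module Recurrence (A γ : ℕ → Carrier) (α : Carrier) (A-0 : A 0 ≈ 1#) (γ-0 : γ 0 ≈ 1#)
    (A-rec : ∀ n → A (suc n) ≈ α * sumK n (λ j → γ j * fromℕ (n P′ j) * A (n ∸ j)))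
    where

    -- Since n may be smaller than d, the sum is first extended to d + n, where the terms with j > n
    -- have weight 0, and then cut at d, beyond which the weights vanish in the ring.
    A-rec-truncated : ∀ d → (∀ n → fromℕ (n P′ suc d) ≈ 0#) → ∀ n →
      A (suc n) ≈ α * sumK d (λ j → γ j * fromℕ (n P′ j) * A (n ∸ j))
    A-rec-truncated d P′≈0 n = trans (A-rec n) (*-congˡ (trans
      (sym (sumK-extend (ℕₚ.≤⇒≤′ (ℕₚ.m≤n+m n d)) λ j n<j →
        term-0 j (reflexive (≡.cong fromℕ (P′-vanish n<j)))))
      (sumK-extend (ℕₚ.≤⇒≤′ (ℕₚ.m≤m+n d n)) λ j d<j →
        term-0 j (P′-annihilated n (ℕₚ.≤⇒≤′ d<j) (P′≈0 n)))))
      where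
      term-0 : ∀ j → fromℕ (n P′ j) ≈ 0# → γ j * fromℕ (n P′ j) * A (n ∸ j) ≈ 0#
      term-0 j eq = trans (*-congʳ (trans (*-congˡ eq) (zeroʳ _))) (zeroˡ _)

    module Two (2≈0 : fromℕ 2 ≈ 0#) (α-unit : Unit α) (α+γ₁-unit : Unit (α + γ 1)) where

      P′-2 : ∀ n → fromℕ (n P′ 2) ≈ 0#
      P′-2 zero    = refl
      P′-2 (suc n) = trans (fromℕ-* n (suc n ℕ.* 1))
        (trans (*-congˡ (trans (fromℕ-* (suc n) 1) (trans (*-congˡ (+-identityʳ 1#)) (*-identityʳ _)))) (consecutive n))
        where
        -- Neighbouring products differ by a multiple of 2: (i+1)(i+2) = 2(i+1) + i(i+1).
        consecutive : ∀ i → fromℕ i * fromℕ (suc i) ≈ 0#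
        consecutive zero    = zeroˡ _
        consecutive (suc i) = begin
          fromℕ (suc i) * (1# + (1# + fromℕ i))
            ≈⟨ solve 2 (λ x y → x :* (con (+ 1) :+ (con (+ 1) :+ y)) := x :* con (+ 2) :+ y :* x) refl _ _ ⟩
          fromℕ (suc i) * fromℕ 2 + fromℕ i * fromℕ (suc i)
            ≈⟨ +-cong (trans (*-congˡ 2≈0) (zeroʳ _)) (consecutive i) ⟩
          0# + 0#
            ≈⟨ +-identityˡ 0# ⟩
          0# ∎

      -- Only the residue of n matters, so its value `N` in the ring is a parameter. At n = 0 the
      -- truncated index `n ∸ 1` is harmless, the coefficient being 0.
      A-step : ∀ n {N} → fromℕ n ≈ N → A (suc n) ≈ α * (A n + γ 1 * N * A (n ∸ 1))
      A-step n {N} n≈N = trans (A-rec-truncated 1 P′-2 n) (*-congˡ (+-cong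
        (trans (*-congʳ (trans (*-cong γ-0 (+-identityʳ 1#)) (*-identityˡ _))) (*-identityˡ _))
        (*-congʳ (*-congˡ (trans (reflexive (≡.cong fromℕ (ℕₚ.*-identityʳ n))) n≈N)))))

      A-odd : ∀ q → A (1 ℕ.+ q ℕ.* 2) ≈ α * A (q ℕ.* 2)
      A-odd q = trans (A-step (q ℕ.* 2) (fromℕ-+-multiple 2≈0 0 q))
        (solve 4 (λ α x y γ → α :* (x :+ γ :* con (+ 0) :* y) := α :* x) refl _ _ _ _)

      A-even : ∀ q → A (2 ℕ.+ q ℕ.* 2) ≈ α * (α + γ 1) * A (q ℕ.* 2)
      A-even q = begin
        A (2 ℕ.+ q ℕ.* 2)
          ≈⟨ A-step (1 ℕ.+ q ℕ.* 2) (trans (fromℕ-+-multiple 2≈0 1 q) (+-identityʳ 1#)) ⟩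
        α * (A (1 ℕ.+ q ℕ.* 2) + γ 1 * 1# * A (q ℕ.* 2))
          ≈⟨ *-congˡ (+-congʳ (A-odd q)) ⟩
        α * (α * A (q ℕ.* 2) + γ 1 * 1# * A (q ℕ.* 2))
          ≈⟨ solve 3 (λ α x γ → α :* (α :* x :+ γ :* con (+ 1) :* x) := α :* (α :+ γ) :* x) refl _ _ _ ⟩
        α * (α + γ 1) * A (q ℕ.* 2) ∎

      A-even-unit : ∀ q → Unit (A (q ℕ.* 2))
      A-even-unit zero    = unit-cong (sym A-0) unit-1
      A-even-unit (suc q) = unit-cong (sym (A-even q)) (unit-* (unit-* α-unit α+γ₁-unit) (A-even-unit q))

      A-unit : ∀ n → Unit (A n)
      A-unit n with n divMod 2
      ... | result q zero       ≡.refl = A-even-unit q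
      ... | result q (suc zero) ≡.refl = unit-cong (sym (A-odd q)) (unit-* α-unit (A-even-unit q))

    module Three (3≈0 : fromℕ 3 ≈ 0#) (α-unit : Unit α) (α+γ₁-unit : Unit (α + γ 1))
      (α²-γ₂-unit : Unit (α * α - γ 2)) where

      P′-3 : ∀ n → fromℕ (n P′ 3) ≈ 0#
      P′-3 zero          = refl
      P′-3 (suc zero)    = refl
      P′-3 (suc (suc n)) = begin
        fromℕ (n ℕ.* (suc n ℕ.* (suc (suc n) ℕ.* 1)))
          ≡⟨ ≡.cong (λ k → fromℕ (n ℕ.* (suc n ℕ.* k))) (ℕₚ.*-identityʳ (suc (suc n))) ⟩
        fromℕ (n ℕ.* (suc n ℕ.* suc (suc n)))
          ≈⟨ trans (fromℕ-* n (suc n ℕ.* suc (suc n))) (*-congˡ (fromℕ-* (suc n) (suc (suc n)))) ⟩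
        fromℕ n * (fromℕ (suc n) * fromℕ (suc (suc n)))
          ≈⟨ consecutive n ⟩
        0# ∎
        where
        -- The difference of neighbouring products is (i+1)(i+2)(i+3) - i(i+1)(i+2) = 3(i+1)(i+2).
        consecutive : ∀ i → fromℕ i * (fromℕ (suc i) * fromℕ (suc (suc i))) ≈ 0#
        consecutive zero    = zeroˡ _
        consecutive (suc i) = begin
          fromℕ (suc i) * (fromℕ (suc (suc i)) * (1# + (1# + (1# + fromℕ i))))
            ≈⟨ solve 3 (λ x y z → x :* (y :* (con (+ 1) :+ (con (+ 1) :+ (con (+ 1) :+ z))))
                 := x :* y :* con (+ 3) :+ z :* (x :* y)) refl _ _ _ ⟩
          fromℕ (suc i) * fromℕ (suc (suc i)) * fromℕ 3
            + fromℕ i * (fromℕ (suc i) * fromℕ (suc (suc i)))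
            ≈⟨ +-cong (trans (*-congˡ 3≈0) (zeroʳ _)) (consecutive i) ⟩
          0# + 0#
            ≈⟨ +-identityˡ 0# ⟩
          0# ∎

      A-step : ∀ n {N M} → fromℕ n ≈ N → fromℕ (n P′ 2) ≈ M →
        A (suc n) ≈ α * (A n + γ 1 * N * A (n ∸ 1) + γ 2 * M * A (n ∸ 2))
      A-step n n≈N P′≈M = trans (A-rec-truncated 2 P′-3 n) (*-congˡ (+-cong (+-cong
        (trans (*-congʳ (trans (*-cong γ-0 (+-identityʳ 1#)) (*-identityˡ _))) (*-identityˡ _))
        (*-congʳ (*-congˡ (trans (reflexive (≡.cong fromℕ (ℕₚ.*-identityʳ n))) n≈N))))
        (*-congʳ (*-congˡ P′≈M))))

      fromℕ-P′-2 : ∀ n {x y} → fromℕ n ≈ x → fromℕ (suc n) ≈ y → fromℕ (suc n P′ 2) ≈ x * y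
      fromℕ-P′-2 n n≈x 1+n≈y = trans (fromℕ-* n (suc n ℕ.* 1))
        (*-cong n≈x (trans (reflexive (≡.cong fromℕ (ℕₚ.*-identityʳ (suc n)))) 1+n≈y))

      A-1 : ∀ q → A (1 ℕ.+ q ℕ.* 3) ≈ α * A (q ℕ.* 3)
      A-1 q = trans (A-step (q ℕ.* 3) q3≈0
          (P′-annihilated (q ℕ.* 3) {1} {2} (ℕ.≤′-step ℕ.≤′-refl)
            (trans (reflexive (≡.cong fromℕ (ℕₚ.*-identityʳ (q ℕ.* 3)))) q3≈0)))
        (solve 6 (λ α x y z γ δ → α :* (x :+ γ :* con (+ 0) :* y :+ δ :* con (+ 0) :* z) := α :* x)
          refl _ _ _ _ _ _)
        where q3≈0 = fromℕ-+-multiple 3≈0 0 q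

      A-2 : ∀ q → A (2 ℕ.+ q ℕ.* 3) ≈ α * (α + γ 1) * A (q ℕ.* 3)
      A-2 q = begin
        A (2 ℕ.+ q ℕ.* 3)
          ≈⟨ A-step (1 ℕ.+ q ℕ.* 3) q3+1≈1 (fromℕ-P′-2 (q ℕ.* 3) (fromℕ-+-multiple 3≈0 0 q) q3+1≈1) ⟩
        -- At q = 0 the last index truncates to 0; its weight n(n-1) has the factor 3q, already
        -- replaced by `0#`.
        α * (A (1 ℕ.+ q ℕ.* 3) + γ 1 * 1# * A (q ℕ.* 3) + γ 2 * (0# * 1#) * A (q ℕ.* 3 ∸ 1))
          ≈⟨ *-congˡ (+-congʳ (+-congʳ (A-1 q))) ⟩
        α * (α * A (q ℕ.* 3) + γ 1 * 1# * A (q ℕ.* 3) + γ 2 * (0# * 1#) * A (q ℕ.* 3 ∸ 1))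
          ≈⟨ solve 5 (λ α x γ δ y → α :* (α :* x :+ γ :* con (+ 1) :* x :+ δ :* (con (+ 0) :* con (+ 1)) :* y)
               := α :* (α :+ γ) :* x) refl _ _ _ _ _ ⟩
        α * (α + γ 1) * A (q ℕ.* 3) ∎
        where q3+1≈1 = trans (fromℕ-+-multiple 3≈0 1 q) (+-identityʳ 1#)

      A-3 : ∀ q → A (3 ℕ.+ q ℕ.* 3) ≈ α * (α * α - γ 2) * A (q ℕ.* 3)
      A-3 q = begin
        A (3 ℕ.+ q ℕ.* 3)
          ≈⟨ A-step (2 ℕ.+ q ℕ.* 3) q3+2≈2 (fromℕ-P′-2 (1 ℕ.+ q ℕ.* 3) q3+1≈1 q3+2≈2) ⟩
        α * (A (2 ℕ.+ q ℕ.* 3) + γ 1 * fromℕ 2 * A (1 ℕ.+ q ℕ.* 3) + γ 2 * (1# * fromℕ 2) * A (q ℕ.* 3))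
          ≈⟨ *-congˡ (+-congʳ (+-cong (A-2 q) (*-congˡ (A-1 q)))) ⟩
        α * (α * (α + γ 1) * A (q ℕ.* 3) + γ 1 * fromℕ 2 * (α * A (q ℕ.* 3)) + γ 2 * (1# * fromℕ 2) * A (q ℕ.* 3))
          -- Here n ≡ 2 and n(n-1) ≡ 2. The two terms in g(2) add up to 3αg(2), and 2g(3) = 3g(3) -
          -- g(3), so modulo 3 the bracket is α² - g(3).
          ≈⟨ solve 4 (λ α x γ δ → α :* (α :* (α :+ γ) :* x :+ γ :* con (+ 2) :* (α :* x) :+ δ :* (con (+ 1) :* con (+ 2)) :* x)
               := α :* (α :* α :- δ) :* x :+ con (+ 3) :* (α :* x :* (α :* γ :+ δ))) refl _ _ _ _ ⟩
        α * (α * α - γ 2) * A (q ℕ.* 3) + fromℕ 3 * (α * A (q ℕ.* 3) * (α * γ 1 + γ 2))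
          ≈⟨ trans (+-congˡ (trans (*-congʳ 3≈0) (zeroˡ _))) (+-identityʳ _) ⟩
        α * (α * α - γ 2) * A (q ℕ.* 3) ∎
        where
        q3+1≈1 = trans (fromℕ-+-multiple 3≈0 1 q) (+-identityʳ 1#)
        q3+2≈2 = fromℕ-+-multiple 3≈0 2 q

      A-0-unit : ∀ q → Unit (A (q ℕ.* 3))
      A-0-unit zero    = unit-cong (sym A-0) unit-1
      A-0-unit (suc q) = unit-cong (sym (A-3 q)) (unit-* (unit-* α-unit α²-γ₂-unit) (A-0-unit q))

      A-unit : ∀ n → Unit (A n)
      A-unit n with n divMod 3
      ... | result q zero             ≡.refl = A-0-unit q
      ... | result q (suc zero)       ≡.refl = unit-cong (sym (A-1 q)) (unit-* α-unit (A-0-unit q))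
      ... | result q (suc (suc zero)) ≡.refl =
        unit-cong (sym (A-2 q)) (unit-* (unit-* α-unit α+γ₁-unit) (A-0-unit q))

-- Finitely generated additive groups, their multipliers and Nakayama's lemma

module IntegerSpan {c ℓ : Level} (R : CommutativeRing c ℓ) where
  open CommutativeRing R
  open RingOps R
  open IntegerImage R
  open SetoidReasoning setoid

  data Span : List Carrier → Carrier → Set (c ⊔ ℓ) where
    nil  : ∀ {x} → x ≈ 0# → Span [] x
    cons : ∀ {v vs x y} (z : ℤ) → Span vs y → x ≈ fromℤ z * v + y → Span (v ∷ vs) x

  span-cong : ∀ {vs x y} → x ≈ y → Span vs x → Span vs y
  span-cong x≈y (nil x≈0)      = nil (trans (sym x≈y) x≈0)
  span-cong x≈y (cons z s x≈)  = cons z s (trans (sym x≈y) x≈)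

  span-0 : ∀ vs → Span vs 0#
  span-0 []       = nil refl
  span-0 (v ∷ vs) = cons (+ 0) (span-0 vs)
    (solve 1 (λ v → con (+ 0) := con (+ 0) :* v :+ con (+ 0)) refl v)

  span-+ : ∀ {vs x y} → Span vs x → Span vs y → Span vs (x + y)
  span-+ (nil x≈0) (nil y≈0) = nil (trans (+-cong x≈0 y≈0) (+-identityˡ 0#))
  span-+ (cons {v} {y = x′} z s x≈) (cons {y = y′} w t y≈) = cons (z ℤ.+ w) (span-+ s t) (begin
    _                                              ≈⟨ +-cong x≈ y≈ ⟩
    (fromℤ z * v + x′) + (fromℤ w * v + y′)        ≈⟨ solve 5 (λ z v x w y → (z :* v :+ x) :+ (w :* v :+ y)
                                                       := (z :+ w) :* v :+ (x :+ y)) refl _ _ _ _ _ ⟩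
    (fromℤ z + fromℤ w) * v + (x′ + y′)            ≈⟨ +-congʳ (*-congʳ (fromℤ-+ z w)) ⟨
    fromℤ (z ℤ.+ w) * v + (x′ + y′)                ∎)

  span-scale : ∀ {vs x} z → Span vs x → Span vs (fromℤ z * x)
  span-scale z (nil x≈0) = nil (trans (*-congˡ x≈0) (zeroʳ _))
  span-scale z (cons {v} {y = y} w s x≈) = cons (z ℤ.* w) (span-scale z s) (begin
    _                                      ≈⟨ *-congˡ x≈ ⟩
    fromℤ z * (fromℤ w * v + y)            ≈⟨ solve 4 (λ z w v y → z :* (w :* v :+ y) := z :* w :* v :+ z :* y) refl _ _ _ _ ⟩
    fromℤ z * fromℤ w * v + fromℤ z * y    ≈⟨ +-congʳ (*-congʳ (fromℤ-* z w)) ⟨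
    fromℤ (z ℤ.* w) * v + fromℤ z * y      ∎)

  span-neg : ∀ {vs x} → Span vs x → Span vs (- x)
  span-neg {x = x} s = span-cong
    (trans (*-congʳ (-‿cong fromℤ-1)) (solve 1 (λ x → :- con (+ 1) :* x := :- x) refl x))
    (span-scale -[1+ 0 ] s)

  span-weaken : ∀ {v vs x} → Span vs x → Span (v ∷ vs) x
  span-weaken {v} s = cons (+ 0) s (solve 2 (λ v x → x := con (+ 0) :* v :+ x) refl v _)

  span-∈ : ∀ {v vs} → v ∈ vs → Span vs v
  span-∈ {v} {vs = _ ∷ vs} (here ≡.refl) = cons (+ 1) (span-0 vs)
    (sym (trans (+-identityʳ _) (trans (*-congʳ fromℤ-1) (*-identityˡ v))))
  span-∈ (there v∈vs) = span-weaken (span-∈ v∈vs)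

  -- The multipliers of ⟨vs⟩ stand in for ℤ[θ]: closure under products is composition, so no
  -- structure constants or normal forms are involved.
  Stable : List Carrier → Carrier → Set (c ⊔ ℓ)
  Stable vs x = ∀ {y} → Span vs y → Span vs (x * y)

  stable-gen : ∀ {vs x} → All (λ v → Span vs (x * v)) vs → Stable vs x
  stable-gen {ws} {x} xws = go xws
    where
    -- The induction consumes the source generators `vs` while the target `ws` stays fixed.
    go : ∀ {vs y} → All (λ v → Span ws (x * v)) vs → Span vs y → Span ws (x * y)
    go [] (nil y≈0) = span-cong (sym (trans (*-congˡ y≈0) (zeroʳ x))) (span-0 ws)
    go (xv ∷ xvs) (cons {v} {y = y′} z s y≈) = span-cong
      (trans (solve 4 (λ x z v y → z :* (x :* v) :+ x :* y := x :* (z :* v :+ y)) refl _ _ _ _) (*-congˡ (sym y≈)))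
      (span-+ (span-scale z xv) (go xvs s))

  stable-cong : ∀ {vs x y} → x ≈ y → Stable vs x → Stable vs y
  stable-cong x≈y s t = span-cong (*-congʳ x≈y) (s t)

  stable-fromℤ : ∀ {vs} z → Stable vs (fromℤ z)
  stable-fromℤ z = span-scale z

  stable-0 : ∀ {vs} → Stable vs 0#
  stable-0 = span-scale (+ 0)

  stable-1 : ∀ {vs} → Stable vs 1#
  stable-1 = span-cong (sym (*-identityˡ _))

  stable-+ : ∀ {vs x y} → Stable vs x → Stable vs y → Stable vs (x + y)
  stable-+ s t u = span-cong (sym (distribʳ _ _ _)) (span-+ (s u) (t u))

  stable-* : ∀ {vs x y} → Stable vs x → Stable vs y → Stable vs (x * y)
  stable-* s t u = span-cong (sym (*-assoc _ _ _)) (s (t u))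

  stable-neg : ∀ {vs x} → Stable vs x → Stable vs (- x)
  stable-neg {x = x} s {y} u =
    span-cong (solve 2 (λ x y → :- (x :* y) := :- x :* y) refl x y) (span-neg (s u))

  stable-sumK : ∀ {vs} n {f : ℕ → Carrier} → (∀ i → i ℕ.≤ n → Stable vs (f i)) → Stable vs (sumK n f)
  stable-sumK zero    s = s 0 z≤n
  stable-sumK (suc n) s =
    stable-+ (stable-sumK n (λ i i≤n → s i (ℕₚ.m≤n⇒m≤1+n i≤n))) (s (suc n) ℕₚ.≤-refl)

  module _ (p : ℕ) where

    -- x lies in p ⟨vs⟩ after multiplication by an integer ≡ 1 mod p.
    Divisible : List Carrier → Carrier → Set (c ⊔ ℓ)
    Divisible vs x = ∃[ k ] ∃[ y ] (Span vs y × fromℤ (+ 1 ℤ.+ k ℤ.* + p) * x ≈ fromℕ p * y)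

    Torsion : ℤ → Carrier → Set ℓ
    Torsion k x = fromℤ (+ 1 ℤ.+ k ℤ.* + p) * x ≈ 0#

    -- The integers congruent to 1 modulo p are closed under products. Inverting them is the part of
    -- localisation at p that the elimination below uses.
    unit-product : ∀ i j → fromℤ (+ 1 ℤ.+ (i ℤ.+ j ℤ.+ i ℤ.* j ℤ.* + p) ℤ.* + p) ≈
                           fromℤ (+ 1 ℤ.+ i ℤ.* + p) * fromℤ (+ 1 ℤ.+ j ℤ.* + p)
    unit-product i j = trans (reflexive (≡.cong fromℤ
      (ℤS.solve 3 (λ i j p → ℤS.con (+ 1) ℤS.:+ (i ℤS.:+ j ℤS.:+ i ℤS.:* j ℤS.:* p) ℤS.:* p
         ℤS.:= (ℤS.con (+ 1) ℤS.:+ i ℤS.:* p) ℤS.:* (ℤS.con (+ 1) ℤS.:+ j ℤS.:* p)) ≡.refl i j (+ p))))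
      (fromℤ-* (+ 1 ℤ.+ i ℤ.* + p) (+ 1 ℤ.+ j ℤ.* + p))

    torsion-* : ∀ i j {x} → Torsion j x → Torsion (i ℤ.+ j ℤ.+ i ℤ.* j ℤ.* + p) x
    torsion-* i j t = trans (*-congʳ (unit-product i j))
      (trans (*-assoc _ _ _) (trans (*-congˡ t) (zeroʳ _)))

    span-torsion : ∀ {vs k x} → All (Torsion k) vs → Span vs x → Torsion k x
    span-torsion [] (nil x≈0) = trans (*-congˡ x≈0) (zeroʳ _)
    span-torsion {k = k} (t ∷ ts) (cons {v} {y = y} z s x≈) = begin
      u * _                        ≈⟨ *-congˡ x≈ ⟩
      u * (fromℤ z * v + y)        ≈⟨ solve 4 (λ u z v y → u :* (z :* v :+ y) := z :* (u :* v) :+ u :* y) refl _ _ _ _ ⟩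
      fromℤ z * (u * v) + u * y    ≈⟨ +-cong (trans (*-congˡ t) (zeroʳ _)) (span-torsion {k = k} ts s) ⟩
      0# + 0#                      ≈⟨ +-identityˡ 0# ⟩
      0#                           ∎
      where u = fromℤ (+ 1 ℤ.+ k ℤ.* + p)

    -- Nakayama's lemma for ℤ₍ₚ₎: a generator v with (1 + kp) v ∈ p ⟨v, vs⟩ satisfies
    -- (1 + k′p) v ∈ p ⟨vs⟩ and can be eliminated from the other relations.
    nakayama : ∀ vs → All (Divisible vs) vs → ∃[ k ] All (Torsion k) vs
    nakayama []       []                                = + 0 , []
    nakayama (v ∷ vs) ((k , y , cons {y = y′} z s y≈ , kv≈py) ∷ ds) =
      i ℤ.+ j ℤ.+ i ℤ.* j ℤ.* + p , head-torsion ∷ All.map (torsion-* i j) ts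
      where
      -- From (1 + kp) v = p (z v + y′), moving the v-term to the left leaves (1 + (k - z)p) v = p
      -- y′.
      i = k ℤ.- z

      i-spec : fromℤ (+ 1 ℤ.+ i ℤ.* + p) ≈ fromℤ (+ 1 ℤ.+ k ℤ.* + p) - fromℤ z * fromℕ p
      i-spec = begin
        fromℤ (+ 1 ℤ.+ i ℤ.* + p)                ≈⟨ trans (fromℤ-+ (+ 1) (i ℤ.* + p)) (+-cong fromℤ-1 (fromℤ-* i (+ p))) ⟩
        1# + fromℤ i * fromℕ p                   ≈⟨ +-congˡ (*-congʳ (trans (fromℤ-+ k (ℤ.- z)) (+-congˡ (fromℤ-neg z)))) ⟩
        1# + (fromℤ k - fromℤ z) * fromℕ p       ≈⟨ solve 4 (λ o k z p → o :+ (k :- z) :* p := o :+ k :* p :- z :* p) refl _ _ _ _ ⟩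
        1# + fromℤ k * fromℕ p - fromℤ z * fromℕ p
          ≈⟨ +-congʳ (trans (fromℤ-+ (+ 1) (k ℤ.* + p)) (+-cong fromℤ-1 (fromℤ-* k (+ p)))) ⟨
        fromℤ (+ 1 ℤ.+ k ℤ.* + p) - fromℤ z * fromℕ p ∎

      eliminated : fromℤ (+ 1 ℤ.+ i ℤ.* + p) * v ≈ fromℕ p * y′
      eliminated = begin
        fromℤ (+ 1 ℤ.+ i ℤ.* + p) * v
          ≈⟨ *-congʳ i-spec ⟩
        (fromℤ (+ 1 ℤ.+ k ℤ.* + p) - fromℤ z * fromℕ p) * v
          ≈⟨ solve 4 (λ u z p v → (u :- z :* p) :* v := u :* v :- p :* (z :* v)) refl _ _ _ _ ⟩
        fromℤ (+ 1 ℤ.+ k ℤ.* + p) * v - fromℕ p * (fromℤ z * v)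
          ≈⟨ +-congʳ (trans kv≈py (*-congˡ y≈)) ⟩
        fromℕ p * (fromℤ z * v + y′) - fromℕ p * (fromℤ z * v)
          ≈⟨ solve 4 (λ p z v y → p :* (z :* v :+ y) :- p :* (z :* v) := p :* y) refl _ _ _ _ ⟩
        fromℕ p * y′ ∎

      -- Multiplying a relation by 1 + ip turns its v-term into a multiple of (1 + ip) v = p y′,
      -- which lies in the span of the remaining generators.
      reduce : ∀ {w} → Divisible (v ∷ vs) w → Divisible vs w
      reduce {w} (k′ , x , cons {y = x′} z′ s′ x≈ , k′w≈px) =
        i ℤ.+ k′ ℤ.+ i ℤ.* k′ ℤ.* + p ,
        fromℤ (+ p ℤ.* z′) * y′ + fromℤ (+ 1 ℤ.+ i ℤ.* + p) * x′ ,
        span-+ (span-scale (+ p ℤ.* z′) s) (span-scale (+ 1 ℤ.+ i ℤ.* + p) s′) , (begin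
        fromℤ (+ 1 ℤ.+ (i ℤ.+ k′ ℤ.+ i ℤ.* k′ ℤ.* + p) ℤ.* + p) * w
          ≈⟨ trans (*-congʳ (unit-product i k′)) (*-assoc _ _ _) ⟩
        u * (fromℤ (+ 1 ℤ.+ k′ ℤ.* + p) * w)
          ≈⟨ *-congˡ (trans k′w≈px (*-congˡ x≈)) ⟩
        u * (fromℕ p * (fromℤ z′ * v + x′))
          ≈⟨ solve 5 (λ u p z v x → u :* (p :* (z :* v :+ x)) := p :* (z :* (u :* v) :+ u :* x)) refl _ _ _ _ _ ⟩
        fromℕ p * (fromℤ z′ * (u * v) + u * x′)
          ≈⟨ *-congˡ (+-congʳ (*-congˡ eliminated)) ⟩
        fromℕ p * (fromℤ z′ * (fromℕ p * y′) + u * x′)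
          ≈⟨ *-congˡ (+-congʳ (trans (*-congʳ (fromℤ-* (+ p) z′))
               (solve 3 (λ p z y → p :* z :* y := z :* (p :* y)) refl _ _ _))) ⟨
        fromℕ p * (fromℤ (+ p ℤ.* z′) * y′ + u * x′) ∎)
        where u = fromℤ (+ 1 ℤ.+ i ℤ.* + p)

      tail-torsion = nakayama vs (All.map reduce ds)
      j  = proj₁ tail-torsion
      ts = proj₂ tail-torsion

      -- After scaling by 1 + ip, v becomes p y′ with y′ in ⟨vs⟩, and that group is killed by 1 +
      -- jp.
      head-torsion : Torsion (i ℤ.+ j ℤ.+ i ℤ.* j ℤ.* + p) v
      head-torsion = begin
        fromℤ (+ 1 ℤ.+ (i ℤ.+ j ℤ.+ i ℤ.* j ℤ.* + p) ℤ.* + p) * v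
          ≈⟨ *-congʳ (unit-product i j) ⟩
        fromℤ (+ 1 ℤ.+ i ℤ.* + p) * fromℤ (+ 1 ℤ.+ j ℤ.* + p) * v
          ≈⟨ solve 3 (λ a b v → a :* b :* v := b :* (a :* v)) refl _ _ _ ⟩
        fromℤ (+ 1 ℤ.+ j ℤ.* + p) * (fromℤ (+ 1 ℤ.+ i ℤ.* + p) * v)
          ≈⟨ *-congˡ eliminated ⟩
        fromℤ (+ 1 ℤ.+ j ℤ.* + p) * (fromℕ p * y′)
          ≈⟨ solve 3 (λ a b v → a :* (b :* v) := b :* (a :* v)) refl _ _ _ ⟩
        fromℕ p * (fromℤ (+ 1 ℤ.+ j ℤ.* + p) * y′)
          ≈⟨ trans (*-congˡ (span-torsion {k = j} ts s)) (zeroʳ _) ⟩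
        0# ∎

    -- If p has an inverse δ among the multipliers, then v = p (δ v) for every generator, so M = pM
    -- and Nakayama applies with k = 0.
    all-divisible : ∀ vs {δ} → 1# ≈ fromℕ p * δ → Stable vs δ → All (Divisible vs) vs
    all-divisible vs {δ} 1≈pδ δ-stable = All.tabulate λ {v} v∈vs →
      + 0 , δ * v , δ-stable (span-∈ v∈vs) ,
      trans (*-congʳ fromℤ-1) (trans (*-congʳ 1≈pδ) (*-assoc _ _ _))

-- The multiplier ring modulo p

module StableQuotient {c ℓ : Level} (R : CommutativeRing c ℓ)
  (vs : List (CommutativeRing.Carrier R)) (p : ℕ) where
  open CommutativeRing R
  open RingOps R
  open IntegerImage R
  open IntegerSpan R

  -- The ring S / pS for S = {x | x ⟨vs⟩ ⊆ ⟨vs⟩}.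
  infix 4 _~_
  _~_ : Carrier → Carrier → Set (c ⊔ ℓ)
  x ~ y = ∃[ z ] (Stable vs z × x ≈ y + fromℕ p * z)

  ≈⇒~ : ∀ {x y} → x ≈ y → x ~ y
  ≈⇒~ x≈y = 0# , stable-0 , trans x≈y (solve 2 (λ y p → y := y :+ p :* con (+ 0)) refl _ _)

  ~-sym : ∀ {x y} → x ~ y → y ~ x
  ~-sym (z , s , x≈) = - z , stable-neg s , sym (trans (+-congʳ x≈)
    (solve 3 (λ y p z → y :+ p :* z :+ p :* :- z := y) refl _ _ _))

  ~-trans : ∀ {x y w} → x ~ y → y ~ w → x ~ w
  ~-trans (z , s , x≈) (z′ , s′ , y≈) = z′ + z , stable-+ s′ s , trans x≈ (trans (+-congʳ y≈)
    (solve 4 (λ w p z z′ → w :+ p :* z′ :+ p :* z := w :+ p :* (z′ :+ z)) refl _ _ _ _))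

  ~-+ : ∀ {x x′ y y′} → x ~ x′ → y ~ y′ → x + y ~ x′ + y′
  ~-+ (z , s , x≈) (w , t , y≈) = z + w , stable-+ s t , trans (+-cong x≈ y≈)
    (solve 5 (λ x y p z w → x :+ p :* z :+ (y :+ p :* w) := x :+ y :+ p :* (z :+ w)) refl _ _ _ _ _)

  -- Here x y - x′ y′ = p (z y + x′ w); stability of `y` and `x′` places the cofactor in S.
  ~-* : ∀ {x x′ y y′} → Stable vs y → Stable vs x′ → x ~ x′ → y ~ y′ → x * y ~ x′ * y′
  ~-* {x} {x′} {y} {y′} ys x′s (z , s , x≈) (w , t , y≈) =
    z * y + x′ * w , stable-+ (stable-* s ys) (stable-* x′s t) ,
    trans (*-congʳ x≈) (trans (solve 4 (λ x p z y → (x :+ p :* z) :* y := x :* y :+ p :* (z :* y)) refl _ _ _ _)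
      (trans (+-congʳ (*-congˡ y≈))
        (solve 6 (λ x p z y w y₁ → x :* (y :+ p :* w) :+ p :* (z :* y₁) := x :* y :+ p :* (z :* y₁ :+ x :* w))
          refl _ _ _ _ _ _)))

  ~-neg : ∀ {x y} → x ~ y → - x ~ - y
  ~-neg (z , s , x≈) = - z , stable-neg s , trans (-‿cong x≈)
    (solve 3 (λ y p z → :- (y :+ p :* z) := :- y :+ p :* :- z) refl _ _ _)

  quotient : CommutativeRing (c ⊔ ℓ) (c ⊔ ℓ)
  quotient = record
    { Carrier = ∃[ x ] Stable vs x
    ; _≈_ = λ x y → proj₁ x ~ proj₁ y
    ; _+_ = λ (x , s) (y , t) → x + y , stable-+ s t
    ; _*_ = λ (x , s) (y , t) → x * y , stable-* s t
    ; -_  = λ (x , s) → - x , stable-neg s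
    ; 0#  = 0# , stable-0
    ; 1#  = 1# , stable-1
    ; isCommutativeRing = record
      { isRing = record
        { +-isAbelianGroup = record
          { isGroup = record
            { isMonoid = record
              { isSemigroup = record
                { isMagma = record
                  { isEquivalence = record { refl = ≈⇒~ refl ; sym = ~-sym ; trans = ~-trans }
                  ; ∙-cong = ~-+
                  }
                ; assoc = λ _ _ _ → ≈⇒~ (+-assoc _ _ _)
                }
              ; identity = (λ _ → ≈⇒~ (+-identityˡ _)) , (λ _ → ≈⇒~ (+-identityʳ _))
              }
            ; inverse = (λ _ → ≈⇒~ (-‿inverseˡ _)) , (λ _ → ≈⇒~ (-‿inverseʳ _))
            ; ⁻¹-cong = ~-neg
            }
          ; comm = λ _ _ → ≈⇒~ (+-comm _ _)
          }
        ; *-cong = λ {(_ , _)} {(_ , s)} {(_ , t)} → ~-* t s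
        ; *-assoc = λ _ _ _ → ≈⇒~ (*-assoc _ _ _)
        ; *-identity = (λ _ → ≈⇒~ (*-identityˡ _)) , (λ _ → ≈⇒~ (*-identityʳ _))
        ; distrib = (λ _ _ _ → ≈⇒~ (distribˡ _ _ _)) , (λ _ _ _ → ≈⇒~ (distribʳ _ _ _))
        }
      ; *-comm = λ _ _ → ≈⇒~ (*-comm _ _)
      }
    }

  private module Q = RingOps quotient

  proj₁-fromℕ : ∀ n → proj₁ (Q.fromℕ n) ≡ fromℕ n
  proj₁-fromℕ zero    = ≡.refl
  proj₁-fromℕ (suc n) = ≡.cong (λ x → 1# + x) (proj₁-fromℕ n)

  proj₁-fromℤ : ∀ z → proj₁ (Q.fromℤ z) ≡ fromℤ z
  proj₁-fromℤ (+ n)    = proj₁-fromℕ n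
  proj₁-fromℤ -[1+ n ] = ≡.cong -_ (proj₁-fromℕ (suc n))

  proj₁-sumK : ∀ n f → proj₁ (Q.sumK n f) ≡ sumK n (proj₁ ∘ f)
  proj₁-sumK zero    f = ≡.refl
  proj₁-sumK (suc n) f = ≡.cong (λ x → x + proj₁ (f (suc n))) (proj₁-sumK n f)

  fromℕ-p≈0 : CommutativeRing._≈_ quotient (Q.fromℕ p) (CommutativeRing.0# quotient)
  fromℕ-p≈0 = 1# , stable-1 , trans (reflexive (proj₁-fromℕ p))
    (solve 1 (λ p → p := con (+ 0) :+ p :* con (+ 1)) refl _)

-- Residues modulo 2 and 3, and units of the form aθ + b

module Residues {c ℓ : Level} (R : CommutativeRing c ℓ) where
  open CommutativeRing R
  open RingOps R
  open IntegerImage R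
  open Units R
  open SetoidReasoning setoid

  fromℤ-+-multiple : ∀ {p} → fromℕ p ≈ 0# → ∀ {z} r q → z ≡ r ℤ.+ q ℤ.* + p → fromℤ z ≈ fromℤ r
  fromℤ-+-multiple {p} p≈0 r q ≡.refl = begin
    fromℤ (r ℤ.+ q ℤ.* + p)        ≈⟨ fromℤ-+ r (q ℤ.* + p) ⟩
    fromℤ r + fromℤ (q ℤ.* + p)    ≈⟨ +-congˡ (fromℤ-* q (+ p)) ⟩
    fromℤ r + fromℤ q * fromℕ p    ≈⟨ +-congˡ (trans (*-congˡ p≈0) (zeroʳ _)) ⟩
    fromℤ r + 0#                   ≈⟨ +-identityʳ _ ⟩
    fromℤ r                        ∎

  fromℤ-% : ∀ p .{{_ : ℕ.NonZero p}} → fromℕ p ≈ 0# → ∀ z → fromℤ z ≈ fromℕ (z ℤ.%ℕ p)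
  fromℤ-% p p≈0 z = fromℤ-+-multiple p≈0 (+ (z ℤ.%ℕ p)) (z ℤ./ℕ p) (a≡a%ℕn+[a/ℕn]*n z p)

  -- Since a is its own inverse, aθ + b = a(θ + ab). The coefficient is thereby moved into the
  -- integer shift.
  affine-unit : ∀ a {θ} → fromℤ a * fromℤ a ≈ 1# → (∀ e → Unit (θ + fromℤ e)) →
                ∀ b → Unit (fromℤ a * θ + fromℤ b)
  affine-unit a {θ} a²≈1 units b = unit-cong (begin
    fromℤ a * (θ + fromℤ (a ℤ.* b))              ≈⟨ *-congˡ (+-congˡ (fromℤ-* a b)) ⟩
    fromℤ a * (θ + fromℤ a * fromℤ b)            ≈⟨ solve 3 (λ a θ b → a :* (θ :+ a :* b) := a :* θ :+ a :* a :* b) refl _ _ _ ⟩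
    fromℤ a * θ + fromℤ a * fromℤ a * fromℤ b    ≈⟨ +-congˡ (trans (*-congʳ a²≈1) (*-identityˡ _)) ⟩
    fromℤ a * θ + fromℤ b                        ∎)
    (unit-* (fromℤ a , a²≈1) (units (a ℤ.* b)))

  affine-shift : ∀ a b z {θ} → fromℤ a * θ + fromℤ (b ℤ.+ z) ≈ (fromℤ a * θ + fromℤ b) + fromℤ z
  affine-shift a b z = trans (+-congˡ (fromℤ-+ b z)) (sym (+-assoc _ _ _))

  module Mod2 (2≈0 : fromℕ 2 ≈ 0#) where

    square-one : ∀ a → ¬ (+ 2 ℤˢ.∣ a) → fromℤ a * fromℤ a ≈ 1#
    square-one a 2∤a = trans (*-cong a≈r a≈r) (go (a ℤ.%ℕ 2) ≡.refl (n%ℕd<d a 2))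
      where
      a≈r = fromℤ-% 2 2≈0 a
      go : ∀ r → a ℤ.%ℕ 2 ≡ r → r ℕ.< 2 → fromℕ r * fromℕ r ≈ 1#
      go 0 eq _ = contradiction (ℤˢ.divides (a ℤ./ℕ 2) (≡.trans (a≡a%ℕn+[a/ℕn]*n a 2)
        (≡.trans (≡.cong (λ r → + r ℤ.+ a ℤ./ℕ 2 ℤ.* + 2) eq) (ℤₚ.+-identityˡ _)))) 2∤a
      go 1 _ _ = trans (*-cong (+-identityʳ 1#) (+-identityʳ 1#)) (*-identityˡ 1#)
      go (suc (suc _)) _ (s≤s (s≤s ()))

    shifted-units : ∀ {θ} → Unit θ → Unit (θ - 1#) → ∀ e → Unit (θ + fromℤ e)
    shifted-units {θ} u₀ u₋₁ e = unit-cong (+-congˡ (sym (fromℤ-% 2 2≈0 e))) (go (e ℤ.%ℕ 2) (n%ℕd<d e 2))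
      where
      go : ∀ r → r ℕ.< 2 → Unit (θ + fromℕ r)
      go 0 _ = unit-cong (sym (+-identityʳ θ)) u₀
      -- In characteristic 2 the shift by 1 equals the shift by -1, the form supplied by the
      -- divisibility arguments for θ - 1.
      go 1 _ = unit-cong (trans (trans (sym (+-identityʳ _)) (+-congˡ (sym 2≈0)))
        (solve 1 (λ θ → θ :- con (+ 1) :+ con (+ 2) := θ :+ (con (+ 1) :+ con (+ 0))) refl θ)) u₋₁
      go (suc (suc _)) (s≤s (s≤s ()))

  module Mod3 (3≈0 : fromℕ 3 ≈ 0#) where

    square-one : ∀ a → ¬ (+ 3 ℤˢ.∣ a) → fromℤ a * fromℤ a ≈ 1#
    square-one a 3∤a = trans (*-cong a≈r a≈r) (go (a ℤ.%ℕ 3) ≡.refl (n%ℕd<d a 3))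
      where
      a≈r = fromℤ-% 3 3≈0 a
      go : ∀ r → a ℤ.%ℕ 3 ≡ r → r ℕ.< 3 → fromℕ r * fromℕ r ≈ 1#
      go 0 eq _ = contradiction (ℤˢ.divides (a ℤ./ℕ 3) (≡.trans (a≡a%ℕn+[a/ℕn]*n a 3)
        (≡.trans (≡.cong (λ r → + r ℤ.+ a ℤ./ℕ 3 ℤ.* + 3) eq) (ℤₚ.+-identityˡ _)))) 3∤a
      go 1 _ _ = trans (*-cong (+-identityʳ 1#) (+-identityʳ 1#)) (*-identityˡ 1#)
      go 2 _ _ = begin
        fromℕ 2 * fromℕ 2  ≈⟨ solve 0 (con (+ 2) :* con (+ 2) := con (+ 1) :+ con (+ 3)) refl ⟩
        1# + fromℕ 3       ≈⟨ trans (+-congˡ 3≈0) (+-identityʳ 1#) ⟩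
        1#                 ∎
      go (suc (suc (suc _))) _ (s≤s (s≤s (s≤s ())))

    shifted-units : ∀ {θ} → Unit θ → Unit (θ + 1#) → Unit (θ - 1#) → ∀ e → Unit (θ + fromℤ e)
    shifted-units {θ} u₀ u₁ u₋₁ e = unit-cong (+-congˡ (sym (fromℤ-% 3 3≈0 e))) (go (e ℤ.%ℕ 3) (n%ℕd<d e 3))
      where
      go : ∀ r → r ℕ.< 3 → Unit (θ + fromℕ r)
      go 0 _ = unit-cong (sym (+-identityʳ θ)) u₀
      go 1 _ = unit-cong (+-congˡ (sym (+-identityʳ 1#))) u₁
      -- In characteristic 3 the shift by 2 is the shift by -1.
      go 2 _ = unit-cong (trans (trans (sym (+-identityʳ _)) (+-congˡ (sym 3≈0)))
        (solve 1 (λ θ → θ :- con (+ 1) :+ con (+ 3) := θ :+ con (+ 2)) refl θ)) u₋₁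
      go (suc (suc (suc _))) (s≤s (s≤s (s≤s ())))

module UnitCriterion {c ℓ : Level} (R : CommutativeRing c ℓ) where
  open CommutativeRing R
  open RingOps R
  open IntegerImage R
  open Units R
  open Residues R
  open SmallCharacteristic R

  module Affine (A : ℕ → Carrier) (g : ℕ → ℤ) (a b : ℤ) (θ : Carrier)
    (A-0 : A 0 ≈ 1#) (g1 : g 1 ≡ + 1)
    (A-rec : ∀ n → A (suc n) ≈
      (fromℤ a * θ + fromℤ b) * sumK n (λ j → fromℤ (g (suc j)) * fromℕ (n P′ j) * A (n ∸ j)))
    where
    α = fromℤ a * θ + fromℤ b

    open Recurrence A (λ j → fromℤ (g (suc j))) α A-0
      (trans (reflexive (≡.cong fromℤ g1)) fromℤ-1) A-rec

    A-unit₂ : fromℕ 2 ≈ 0# → ¬ (+ 2 ℤˢ.∣ a) → Unit θ → Unit (θ - 1#) → ∀ n → Unit (A n)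
    A-unit₂ 2≈0 2∤a u₀ u₋₁ =
      Two.A-unit 2≈0 (α+unit b) (unit-cong (affine-shift a b (g 2)) (α+unit (b ℤ.+ g 2)))
      where
      open Mod2 2≈0
      α+unit : ∀ e → Unit (fromℤ a * θ + fromℤ e)
      α+unit = affine-unit a (square-one a 2∤a) (shifted-units u₀ u₋₁)

    A-unit₃ : fromℕ 3 ≈ 0# → ¬ (+ 3 ℤˢ.∣ a) → (+ 3 ℤˢ.∣ g 3) ⊎ (+ 3 ℤˢ.∣ (g 3 ℤ.- + 1)) →
              Unit θ → Unit (θ + 1#) → Unit (θ - 1#) → ∀ n → Unit (A n)
    A-unit₃ 3≈0 3∤a g3 u₀ u₁ u₋₁ =
      Three.A-unit 3≈0 (α+unit b) (unit-cong (affine-shift a b (g 2)) (α+unit (b ℤ.+ g 2))) (α²-g3-unit g3)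
      where
      open Mod3 3≈0
      α+unit : ∀ e → Unit (fromℤ a * θ + fromℤ e)
      α+unit = affine-unit a (square-one a 3∤a) (shifted-units u₀ u₁ u₋₁)

      -- The factor is α · α for g(3) ≡ 0 and (α + 1)(α - 1) for g(3) ≡ 1; either way both factors
      -- have the form aθ + e.
      α²-g3-unit : (+ 3 ℤˢ.∣ g 3) ⊎ (+ 3 ℤˢ.∣ (g 3 ℤ.- + 1)) → Unit (α * α - fromℤ (g 3))
      α²-g3-unit (inj₁ (ℤˢ.divides q g3≡3q)) = unit-cong
        (sym (trans (+-congˡ (-‿cong g3≈0)) (solve 1 (λ x → x :- con (+ 0) := x) refl (α * α))))
        (unit-* (α+unit b) (α+unit b))
        where
        g3≈0 : fromℤ (g 3) ≈ 0#
        g3≈0 = fromℤ-+-multiple 3≈0 (+ 0) q (≡.trans g3≡3q (≡.sym (ℤₚ.+-identityˡ _)))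
      α²-g3-unit (inj₂ (ℤˢ.divides q g3-1≡3q)) = unit-cong
        (trans (*-cong (trans (affine-shift a b (+ 1)) (+-congˡ fromℤ-1))
                       (trans (affine-shift a b -[1+ 0 ]) (+-congˡ (-‿cong fromℤ-1))))
          (trans (solve 1 (λ x → (x :+ con (+ 1)) :* (x :- con (+ 1)) := x :* x :- con (+ 1)) refl α)
            (+-congˡ (-‿cong (sym g3≈1)))))
        (unit-* (α+unit (b ℤ.+ + 1)) (α+unit (b ℤ.+ -[1+ 0 ])))
        where
        g3≈1 : fromℤ (g 3) ≈ 1#
        g3≈1 = trans (fromℤ-+-multiple 3≈0 (+ 1) q (≡.trans
          (ℤS.solve 1 (λ x → x ℤS.:= ℤS.con (+ 1) ℤS.:+ (x ℤS.:- ℤS.con (+ 1))) ≡.refl (g 3))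
          (≡.cong (λ x → + 1 ℤ.+ x) g3-1≡3q))) fromℤ-1

-- From units modulo p to nonvanishing in K

module Nonvanishing {c ℓ : Level} (K : CharZeroField c ℓ)
  (vs : List (CharZeroField.Carrier K)) (1∈vs : CharZeroField.1# K ∈ vs)
  (θ : CharZeroField.Carrier K) (θ-stable : IntegerSpan.Stable (CharZeroField.cring K) vs θ) where
  open CharZeroField K
  open FieldOps K
  open CharZero K
  open IntegerImage cring
  open IntegerSpan cring
  open FiniteSums cring
  open SetoidReasoning setoid

  fromℤ-≈0 : ∀ z → fromℤ z ≈ 0# → z ≡ + 0
  fromℤ-≈0 (+ zero)  _   = ≡.refl
  fromℤ-≈0 (+ suc n) z≈0 = contradiction z≈0 (charZero n)
  fromℤ-≈0 -[1+ n ]  z≈0 = contradiction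
    (trans (solve 1 (λ x → x := :- (:- x)) refl _) (trans (-‿cong z≈0) (solve 0 (:- con (+ 0) := con (+ 0)) refl)))
    (charZero n)

  -- Nakayama gives an integer 1 + kp that kills every generator. Applied to the generator 1 it
  -- vanishes in `K`, hence in ℤ by characteristic zero, and p would divide 1.
  1-not-divisible : ∀ {p} → 1 ℕ.< p → ∀ {δ} → Stable vs δ → ¬ (1# ≈ fromℕ p * δ)
  1-not-divisible {p} 1<p δ-stable 1≈pδ with nakayama p vs (all-divisible p vs 1≈pδ δ-stable)
  ... | k , torsion = ℕₚ.<⇒≢ 1<p (≡.sym (ℕᵈ.∣1⇒≡1 (ℤˢ.∣⇒∣ᵤ {+ p} {+ 1} (ℤˢ.divides (ℤ.- k) 1≡-kp))))
    where
    1+kp≡0 : + 1 ℤ.+ k ℤ.* + p ≡ + 0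
    1+kp≡0 = fromℤ-≈0 _ (trans (sym (*-identityʳ _)) (All.lookup torsion 1∈vs))
    1≡-kp : + 1 ≡ ℤ.- k ℤ.* + p
    1≡-kp = ≡.trans
      (ℤS.solve 2 (λ k p → ℤS.con (+ 1) ℤS.:= (ℤS.con (+ 1) ℤS.:+ k ℤS.:* p) ℤS.:+ ℤS.:- k ℤS.:* p) ≡.refl k (+ p))
      (≡.trans (≡.cong (ℤ._+ ℤ.- k ℤ.* + p) 1+kp≡0) (ℤₚ.+-identityˡ _))

  -- A certificate in place of a norm: a multiplier `w` shows that `x` divides an integer prime to p
  -- inside S.
  Coprime : ℕ → Carrier → Set (c ⊔ ℓ)
  Coprime p x = ∃[ w ] ∃[ z ] (Stable vs w × x * w ≈ fromℤ z × ¬ (+ p ℤˢ.∣ z))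

  module Quotient (p : ℕ) where
    open StableQuotient cring vs p public
    module Q  = CommutativeRing quotient
    module Qₒ = RingOps quotient
    open Units quotient public

    θ̂ : Q.Carrier
    θ̂ = θ , λ {_} → θ-stable

    -- The integer z is inverse to itself modulo p, and a divisor of a unit is a unit.
    coprime⇒unit : (∀ z → ¬ (+ p ℤˢ.∣ z) → Qₒ.fromℤ z Q.* Qₒ.fromℤ z Q.≈ Q.1#) →
                   ∀ (X : Q.Carrier) → Coprime p (proj₁ X) → Unit X
    coprime⇒unit square-one X (w , z , w-stable , xw≈z , p∤z) = unit-factorˡ {X} {W}
      (unit-cong {Qₒ.fromℤ z} {X Q.* W} (≈⇒~ (trans (reflexive (proj₁-fromℤ z)) (sym xw≈z)))
        (Qₒ.fromℤ z , square-one z p∤z))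
      where
      W : Q.Carrier
      W = w , λ {_} → w-stable

  module Reduction (p : ℕ) (1<p : 1 ℕ.< p) (g : ℕ → ℤ) (g1 : g 1 ≡ + 1) (a b : ℤ) where
    open Quotient p

    α : Carrier
    α = fromℤ a * θ + fromℤ b

    α-stable : Stable vs α
    α-stable = stable-+ (stable-* (stable-fromℤ a) θ-stable) (stable-fromℤ b)

    -- Integrality of A_m. The recurrence reaches back to all earlier values, so the bound `n`
    -- carries a course-of-values induction.
    scaledP-stable-≤ : ∀ n m → m ℕ.≤ n → Stable vs (scaledP g α m)
    scaledP-stable-≤ n       zero    _         = stable-cong (sym (scaledP-0 g α)) stable-1
    scaledP-stable-≤ (suc n) (suc m) (s≤s m≤n) = stable-cong (sym (scaledP-rec g α m))
      (stable-* α-stable (stable-sumK m λ j _ →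
        stable-* (stable-* (stable-fromℤ (g (suc j))) (stable-fromℤ (+ (m P′ j))))
          (scaledP-stable-≤ n (m ∸ j) (ℕₚ.≤-trans (ℕₚ.m∸n≤m m j) m≤n))))

    α̂ : Q.Carrier
    α̂ = Qₒ.fromℤ a Q.* θ̂ Q.+ Qₒ.fromℤ b

    Â : ℕ → Q.Carrier
    Â n = scaledP g α n , λ {_} → scaledP-stable-≤ n n ℕₚ.≤-refl

    Â-0 : Â 0 Q.≈ Q.1#
    Â-0 = ≈⇒~ (scaledP-0 g α)

    Â-rec : ∀ n → Â (suc n) Q.≈ α̂ Q.* Qₒ.sumK n (λ j → Qₒ.fromℤ (g (suc j)) Q.* Qₒ.fromℕ (n P′ j) Q.* Â (n ∸ j))
    Â-rec n = ≈⇒~ (begin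
      scaledP g α (suc n)
        ≈⟨ scaledP-rec g α n ⟩
      α * sumK n (λ j → fromℤ (g (suc j)) * fromℕ (n P′ j) * scaledP g α (n ∸ j))
        ≈⟨ *-cong (+-cong (*-congʳ (reflexive (proj₁-fromℤ a))) (reflexive (proj₁-fromℤ b)))
             (sumK-cong n (λ j _ → *-congʳ (*-cong (reflexive (proj₁-fromℤ (g (suc j))))
                                                  (reflexive (proj₁-fromℕ (n P′ j)))))) ⟨
      proj₁ α̂ * sumK n (λ j → proj₁ (Qₒ.fromℤ (g (suc j)) Q.* Qₒ.fromℕ (n P′ j) Q.* Â (n ∸ j)))
        ≈⟨ *-congˡ (reflexive (proj₁-sumK n _)) ⟨
      proj₁ α̂ * proj₁ (Qₒ.sumK n (λ j → Qₒ.fromℤ (g (suc j)) Q.* Qₒ.fromℕ (n P′ j) Q.* Â (n ∸ j))) ∎)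

    -- If P_n(α) were 0, the unit A_n would be represented by 0, so 1 would be congruent to 0, that
    -- is, 1 = pz with z in S.
    evalP-≉0 : ∀ n → Unit (Â n) → ¬ (evalP g n α ≈ 0#)
    evalP-≉0 n (y , Ây~1) P≈0 with ~-trans (~-sym Ây~1)
      (≈⇒~ {scaledP g α n * proj₁ y} {0#} (trans (*-congʳ (trans (*-congˡ P≈0) (zeroʳ _))) (zeroˡ _)))
    ... | z , z-stable , 1≈pz = 1-not-divisible 1<p (λ {_} → z-stable) (trans 1≈pz (+-identityˡ _))

    open UnitCriterion.Affine quotient Â g a b θ̂ Â-0 g1 Â-rec
      using (A-unit₂; A-unit₃) public

  nonvanishing₂ : ∀ a b n g → g 1 ≡ + 1 → ¬ (+ 2 ℤˢ.∣ a) →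
    Coprime 2 θ → Coprime 2 (θ - 1#) → ¬ (evalP g n (fromℤ a * θ + fromℤ b) ≈ 0#)
  nonvanishing₂ a b n g g1 2∤a θ-cop θ-1-cop = evalP-≉0 n
    (A-unit₂ fromℕ-p≈0 2∤a (unit θ̂ θ-cop) (unit (θ̂ Q.- Q.1#) θ-1-cop) n)
    where
    open Quotient 2
    open Reduction 2 (s≤s (s≤s z≤n)) g g1 a b
    unit : ∀ X → Coprime 2 (proj₁ X) → Unit X
    unit = coprime⇒unit (Residues.Mod2.square-one quotient fromℕ-p≈0)

  nonvanishing₃ : ∀ a b n g → g 1 ≡ + 1 → ¬ (+ 3 ℤˢ.∣ a) →
    (+ 3 ℤˢ.∣ g 3) ⊎ (+ 3 ℤˢ.∣ (g 3 ℤ.- + 1)) →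
    Coprime 3 θ → Coprime 3 (θ + 1#) → Coprime 3 (θ - 1#) →
    ¬ (evalP g n (fromℤ a * θ + fromℤ b) ≈ 0#)
  nonvanishing₃ a b n g g1 3∤a g3 θ-cop θ+1-cop θ-1-cop = evalP-≉0 n
    (A-unit₃ fromℕ-p≈0 3∤a g3 (unit θ̂ θ-cop) (unit (θ̂ Q.+ Q.1#) θ+1-cop) (unit (θ̂ Q.- Q.1#) θ-1-cop) n)
    where
    open Quotient 3
    open Reduction 3 (s≤s (s≤s z≤n)) g g1 a b
    unit : ∀ X → Coprime 3 (proj₁ X) → Unit X
    unit = coprime⇒unit (Residues.Mod3.square-one quotient fromℕ-p≈0)

-- Powers, geometric sums and the span of the powers of an element

module Powers {c ℓ : Level} (R : CommutativeRing c ℓ) where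
  open CommutativeRing R
  open RingOps R
  open IntegerImage R
  open IntegerSpan R
  open SetoidReasoning setoid

  ^-cong : ∀ n {x y} → x ≈ y → x ^ n ≈ y ^ n
  ^-cong zero    x≈y = refl
  ^-cong (suc n) x≈y = *-cong x≈y (^-cong n x≈y)

  ^-+ : ∀ x m n → x ^ (m ℕ.+ n) ≈ x ^ m * x ^ n
  ^-+ x zero    n = sym (*-identityˡ _)
  ^-+ x (suc m) n = trans (*-congˡ (^-+ x m n)) (sym (*-assoc _ _ _))

  ^-* : ∀ x m n → x ^ (m ℕ.* n) ≈ (x ^ n) ^ m
  ^-* x zero    n = refl
  ^-* x (suc m) n = trans (^-+ x n (m ℕ.* n)) (*-congˡ (^-* x m n))

  stable-^ : ∀ {vs x} n → Stable vs x → Stable vs (x ^ n)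
  stable-^ zero    s = stable-1
  stable-^ (suc n) s = stable-* s (stable-^ n s)

  1^ : ∀ n → 1# ^ n ≈ 1#
  1^ zero    = refl
  1^ (suc n) = trans (*-identityˡ _) (1^ n)

  geometric : Carrier → ℕ → Carrier
  geometric x zero    = 0#
  geometric x (suc n) = 1# + x * geometric x n

  geometric-spec : ∀ x n → (x - 1#) * geometric x n ≈ x ^ n - 1#
  geometric-spec x zero    = solve 1 (λ x → (x :- con (+ 1)) :* con (+ 0) := con (+ 1) :- con (+ 1)) refl x
  geometric-spec x (suc n) = begin
    (x - 1#) * (1# + x * geometric x n)
      ≈⟨ solve 2 (λ x y → (x :- con (+ 1)) :* (con (+ 1) :+ x :* y) := x :- con (+ 1) :+ x :* ((x :- con (+ 1)) :* y)) refl _ _ ⟩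
    x - 1# + x * ((x - 1#) * geometric x n)
      ≈⟨ +-congˡ (*-congˡ (geometric-spec x n)) ⟩
    x - 1# + x * (x ^ n - 1#)
      ≈⟨ solve 2 (λ x y → x :- con (+ 1) :+ x :* (y :- con (+ 1)) := x :* y :- con (+ 1)) refl _ _ ⟩
    x ^ suc n - 1# ∎

  -- The quotient of (1 + x + ... + x^(n-1)) - n by x - 1, written without division as the sum of
  -- `geometric x i` over i < n, so that it is a multiplier whenever x is.
  geometric-excess : Carrier → ℕ → Carrier
  geometric-excess x zero    = 0#
  geometric-excess x (suc n) = geometric-excess x n + geometric x n

  geometric≈n : ∀ x n → geometric x n ≈ fromℕ n + (x - 1#) * geometric-excess x n
  geometric≈n x zero    = solve 1 (λ x → con (+ 0) := con (+ 0) :+ (x :- con (+ 1)) :* con (+ 0)) refl x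
  geometric≈n x (suc n) = begin
    1# + x * geometric x n
      ≈⟨ solve 2 (λ x y → con (+ 1) :+ x :* y := con (+ 1) :+ y :+ (x :- con (+ 1)) :* y) refl _ _ ⟩
    1# + geometric x n + (x - 1#) * geometric x n
      ≈⟨ +-congʳ (+-congˡ (geometric≈n x n)) ⟩
    1# + (fromℕ n + (x - 1#) * geometric-excess x n) + (x - 1#) * geometric x n
      ≈⟨ solve 4 (λ x n e y → con (+ 1) :+ (n :+ (x :- con (+ 1)) :* e) :+ (x :- con (+ 1)) :* y
           := con (+ 1) :+ n :+ (x :- con (+ 1)) :* (e :+ y)) refl _ _ _ _ ⟩
    fromℕ (suc n) + (x - 1#) * (geometric-excess x n + geometric x n) ∎

  stable-geometric : ∀ {vs x} n → Stable vs x → Stable vs (geometric x n)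
  stable-geometric zero    s = stable-0
  stable-geometric (suc n) s = stable-+ stable-1 (stable-* s (stable-geometric n s))

  stable-geometric-excess : ∀ {vs x} n → Stable vs x → Stable vs (geometric-excess x n)
  stable-geometric-excess zero    s = stable-0
  stable-geometric-excess (suc n) s = stable-+ (stable-geometric-excess n s) (stable-geometric n s)

  powers : Carrier → ℕ → List Carrier
  powers x zero    = []
  powers x (suc n) = x ^ n ∷ powers x n

  ∈-powers : ∀ x {k m} → k ℕ.<′ m → x ^ k ∈ powers x m
  ∈-powers x ℕ.<′-base       = here ≡.refl
  ∈-powers x (ℕ.<′-step k<m) = there (∈-powers x k<m)

  -- Multiplication by x shifts the generators by one; only the top one leaves the list, and the
  -- hypothesis brings it back.
  stable-powers : ∀ x m → Span (powers x m) (x ^ m) → Stable (powers x m) x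
  stable-powers x m xᵐ = stable-gen (go m ℕ.≤′-refl)
    where
    next : ∀ k → suc k ℕ.≤′ m → Span (powers x m) (x ^ suc k)
    next k ℕ.≤′-refl         = xᵐ
    next k (ℕ.≤′-step k<m) = span-∈ (∈-powers x (ℕₚ.s<′s k<m))
    go : ∀ k → k ℕ.≤′ m → All (λ v → Span (powers x m) (x * v)) (powers x k)
    go zero    _   = []
    go (suc k) k<m = next k k<m ∷ go k (ℕₚ.≤′-trans (ℕ.≤′-step ℕ.≤′-refl) k<m)

-- The common form of the residue contradictions below: two expressions for one integer would force
-- p to divide the remainder `r`.
no-multiple : ∀ r i j {p} → ¬ (p ℕᵈ.∣ ℤ.∣ r ∣) → i ℤ.* + p ℤ.+ r ≢ j ℤ.* + p
no-multiple r i j {p} p∤r ip+r≡jp = p∤r (ℤˢ.∣⇒∣ᵤ {+ p} {r} (ℤˢ.divides (j ℤ.- i) (≡.trans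
  (ℤS.solve 3 (λ r i p → r ℤS.:= i ℤS.:* p ℤS.:+ r ℤS.:- i ℤS.:* p) ≡.refl r i (+ p))
  (≡.trans (≡.cong (λ x → x ℤ.- i ℤ.* + p) ip+r≡jp)
    (ℤS.solve 3 (λ i j p → j ℤS.:* p ℤS.:- i ℤS.:* p ℤS.:= (j ℤS.:- i) ℤS.:* p) ≡.refl i j (+ p))))))

prime∤prime : ∀ {p q} → Prime p → Prime q → p ≢ q → ¬ (p ℕᵈ.∣ q)
prime∤prime p-prime q-prime p≢q p∣q with prime⇒irreducible q-prime p∣q
... | inj₁ ≡.refl = ¬prime[1] p-prime
... | inj₂ p≡q    = p≢q p≡q

-- Roots of unity

-- The order is written `suc m`, which makes ζ ^ m the inverse of ζ.
module Cyclotomic {c ℓ : Level} (K : CharZeroField c ℓ) (m : ℕ)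
  (ζ : CharZeroField.Carrier K) (ζ-root : FieldOps.PrimitiveRoot K (suc m) ζ) where
  open CharZeroField K
  open CharZero K
  open IntegerImage cring
  open IntegerSpan cring
  open Powers cring
  open SetoidReasoning setoid

  ζᵐ≈1 : ζ ^ suc m ≈ 1#
  ζᵐ≈1 = proj₁ ζ-root

  1∈powers : 1# ∈ powers ζ (suc m)
  1∈powers = ∈-powers ζ {0} (ℕₚ.≤⇒≤′ (s≤s z≤n))

  ζ-stable : Stable (powers ζ (suc m)) ζ
  ζ-stable = stable-powers ζ (suc m) (span-cong (sym ζᵐ≈1) (span-∈ 1∈powers))

  open Nonvanishing K (powers ζ (suc m)) 1∈powers ζ ζ-stable public

  ζ-coprime : ∀ p → ¬ (p ℕᵈ.∣ 1) → Coprime p ζ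
  ζ-coprime p p∤1 = ζ ^ m , + 1 , stable-^ m ζ-stable , trans ζᵐ≈1 (sym fromℤ-1) ,
    p∤1 ∘ ℤˢ.∣⇒∣ᵤ {+ p} {+ 1}

  -- If η = ξᵏ ≠ 1 and η^q = 1, then 0 = 1 + η + ... + η^(q-1) ≡ q modulo η - 1,
  -- so ξ - 1 divides η - 1, which divides q.
  ξ-1-coprime : ∀ p {ξ} k q → Stable (powers ζ (suc m)) ξ → ¬ (ξ ^ k ≈ 1#) → (ξ ^ k) ^ q ≈ 1# →
                ¬ (p ℕᵈ.∣ q) → Coprime p (ξ - 1#)
  ξ-1-coprime p {ξ} k q ξ-stable η≉1 η^q≈1 p∤q =
    -- The first factor carries ξ - 1 to η - 1, the second carries η - 1 to -q because 0 = q + (η -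
    -- 1) · excess; hence the sign.
    - (geometric ξ k * geometric-excess η q) , + q ,
    stable-neg (stable-* (stable-geometric k ξ-stable) (stable-geometric-excess q (stable-^ k ξ-stable))) ,
    (begin
      (ξ - 1#) * - (geometric ξ k * geometric-excess η q)
        ≈⟨ solve 3 (λ x y z → x :* :- (y :* z) := :- (x :* y :* z)) refl _ _ _ ⟩
      - ((ξ - 1#) * geometric ξ k * geometric-excess η q)
        ≈⟨ -‿cong (*-congʳ (geometric-spec ξ k)) ⟩
      - ((η - 1#) * geometric-excess η q)
        ≈⟨ solve 2 (λ n e → :- e := n :- (n :+ e)) refl (fromℕ q) _ ⟩
      fromℕ q - (fromℕ q + (η - 1#) * geometric-excess η q)
        ≈⟨ +-congˡ (-‿cong (trans (sym (geometric≈n η q)) geometric≈0)) ⟩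
      fromℕ q - 0#
        ≈⟨ solve 1 (λ n → n :- con (+ 0) := n) refl _ ⟩
      fromℕ q ∎) ,
    p∤q ∘ ℤˢ.∣⇒∣ᵤ {+ p} {+ q}
    where
    η = ξ ^ k
    η-1≉0 : ¬ (η - 1# ≈ 0#)
    η-1≉0 eq = η≉1 (trans (solve 1 (λ x → x := x :- con (+ 1) :+ con (+ 1)) refl η)
      (trans (+-congʳ eq) (+-identityˡ 1#)))
    geometric≈0 : geometric η q ≈ 0#
    geometric≈0 = *-cancelʳ η-1≉0 (begin
      geometric η q * (η - 1#)    ≈⟨ *-comm _ _ ⟩
      (η - 1#) * geometric η q    ≈⟨ geometric-spec η q ⟩
      η ^ q - 1#                  ≈⟨ +-congʳ η^q≈1 ⟩
      1# - 1#                     ≈⟨ -‿inverseʳ 1# ⟩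
      0#                          ≈⟨ zeroˡ _ ⟨
      0# * (η - 1#)               ∎)

  -- With m the order, the exponent m/q is smaller than m, so η = ζ^(m/q) differs from 1 while η^q =
  -- 1, and the prime q ≠ 2 is odd.
  ζ-1-coprime₂ : ∀ {q} → Prime q → q ≢ 2 → q ℕᵈ.∣ suc m → Coprime 2 (ζ - 1#)
  ζ-1-coprime₂ {q} q-prime q≢2 (ℕᵈ.divides (suc k) m≡kq) = ξ-1-coprime 2 (suc k) q ζ-stable
    (proj₂ ζ-root (suc k) (s≤s z≤n) (≡.subst (suc k ℕ.<_) (≡.sym m≡kq) (ℕₚ.m<m*n (suc k) q 1<q)))
    (trans (sym (^-* ζ q (suc k))) (trans (reflexive (≡.cong (ζ ^_) (≡.trans (ℕₚ.*-comm q (suc k)) (≡.sym m≡kq)))) ζᵐ≈1))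
    (prime∤prime prime[2] q-prime (q≢2 ∘ ≡.sym))
    where 1<q = ℕ.nonTrivial⇒n>1 q {{prime⇒nonTrivial q-prime}}

  -- Working with ξ = ζ² serves ζ - 1 and ζ + 1 together, since both divide ζ² - 1. The price is
  -- that ζ^(2k) must still differ from 1.
  ζ²-1-coprime₃ : ∀ k q → suc m ℕᵈ.∣ q ℕ.* (suc k ℕ.* 2) → suc k ℕ.* 2 ℕ.< suc m → ¬ (3 ℕᵈ.∣ q) →
                  Coprime 3 (ζ ^ 2 - 1#)
  ζ²-1-coprime₃ k q (ℕᵈ.divides r q2k≡rm) 2k<m = ξ-1-coprime 3 (suc k) q (stable-^ 2 ζ-stable)
    (λ eq → proj₂ ζ-root (suc k ℕ.* 2) (s≤s z≤n) 2k<m (trans (^-* ζ (suc k) 2) eq))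
    (begin
      ((ζ ^ 2) ^ suc k) ^ q        ≈⟨ ^-cong q (^-* ζ (suc k) 2) ⟨
      (ζ ^ (suc k ℕ.* 2)) ^ q      ≈⟨ ^-* ζ q (suc k ℕ.* 2) ⟨
      ζ ^ (q ℕ.* (suc k ℕ.* 2))    ≡⟨ ≡.cong (ζ ^_) q2k≡rm ⟩
      ζ ^ (r ℕ.* suc m)            ≈⟨ ^-* ζ r (suc m) ⟩
      (ζ ^ suc m) ^ r              ≈⟨ ^-cong r ζᵐ≈1 ⟩
      1# ^ r                       ≈⟨ 1^ r ⟩
      1#                           ∎)

  -- With m the order, a prime q > 3 gives η = ζ^(2m/q), where 2m/q < m. If 4 divides m, then η =
  -- ζ^(m/2) = -1 and q = 2. In both cases 3 does not divide q.
  ζ²-1-coprime : (∃[ p ] (Prime p × 3 ℕ.< p × p ℕᵈ.∣ suc m)) ⊎ (4 ℕᵈ.∣ suc m) → Coprime 3 (ζ ^ 2 - 1#)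
  ζ²-1-coprime (inj₁ (q , q-prime , 3<q , ℕᵈ.divides (suc k) m≡kq)) = ζ²-1-coprime₃ k q
    (ℕᵈ.divides 2 (≡.trans (≡.trans (ℕₚ.*-comm q _) (≡.trans (≡.cong (ℕ._* q) (ℕₚ.*-comm (suc k) 2)) (ℕₚ.*-assoc 2 (suc k) q)))
      (≡.cong (2 ℕ.*_) (≡.sym m≡kq))))
    (≡.subst (suc k ℕ.* 2 ℕ.<_) (≡.sym m≡kq) (ℕₚ.*-monoʳ-< (suc k) (ℕₚ.<-trans (s≤s (s≤s (s≤s z≤n))) 3<q)))
    (prime∤prime (from-yes (prime? 3)) q-prime (ℕₚ.<⇒≢ 3<q))
  ζ²-1-coprime (inj₂ (ℕᵈ.divides (suc k) m≡k4)) = ζ²-1-coprime₃ k 2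
    (ℕᵈ.divides 1 (≡.trans (≡.trans (ℕₚ.*-comm 2 _) (ℕₚ.*-assoc (suc k) 2 2)) (≡.trans (≡.sym m≡k4) (≡.sym (ℕₚ.*-identityˡ _)))))
    (≡.subst (suc k ℕ.* 2 ℕ.<_) (≡.sym m≡k4) (ℕₚ.*-monoʳ-< (suc k) (s≤s (s≤s (s≤s z≤n)))))
    (from-no (3 ℕᵈ.∣? 2))

  ζ-1-coprime₃ : Coprime 3 (ζ ^ 2 - 1#) → Coprime 3 (ζ - 1#)
  ζ-1-coprime₃ (w , z , w-stable , eq , 3∤z) = (ζ + 1#) * w , z ,
    stable-* (stable-+ ζ-stable stable-1) w-stable ,
    trans (solve 2 (λ x w → (x :- con (+ 1)) :* ((x :+ con (+ 1)) :* w)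
      := (x :* (x :* con (+ 1)) :- con (+ 1)) :* w) refl ζ w) eq , 3∤z

  ζ+1-coprime₃ : Coprime 3 (ζ ^ 2 - 1#) → Coprime 3 (ζ + 1#)
  ζ+1-coprime₃ (w , z , w-stable , eq , 3∤z) = (ζ - 1#) * w , z ,
    stable-* (stable-+ ζ-stable (stable-neg stable-1)) w-stable ,
    trans (solve 2 (λ x w → (x :+ con (+ 1)) :* ((x :- con (+ 1)) :* w)
      := (x :* (x :* con (+ 1)) :- con (+ 1)) :* w) refl ζ w) eq , 3∤z

-- Quadratic integers

module Quadratic {c ℓ : Level} (K : CharZeroField c ℓ) where
  open CharZeroField K
  open IntegerImage cring
  open IntegerSpan cring

  module MonicRoot (θ : Carrier) (u v : ℤ) (θ² : θ * θ ≈ fromℤ u * θ + fromℤ v) where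

    basis : List Carrier
    basis = θ ∷ 1# ∷ []

    θ-stable : Stable basis θ
    θ-stable = stable-gen
      ( cons u (cons v (nil refl) (solve 1 (λ v → v := v :* con (+ 1) :+ con (+ 0)) refl _)) θ²
      ∷ span-cong (sym (*-identityʳ θ)) (span-∈ (here ≡.refl))
      ∷ [])

    open Nonvanishing K basis (there (here ≡.refl)) θ θ-stable public

module QuadraticField {c ℓ : Level} (K : CharZeroField c ℓ)
  (D : ℤ) (s : CharZeroField.Carrier K) (s² : FieldOps.IsSqrt K D s) where
  open CharZeroField K
  open FieldOps K
  open IntegerImage cring
  open IntegerSpan cring
  open SetoidReasoning setoid

  data OmegaView : Carrier → Set c where
    half : ∀ e → D ≡ + 1 ℤ.+ e ℤ.* + 4 → OmegaView ((1# + s) * (fromℕ 2 ⁻¹))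
    root : ¬ (+ 4 ℤˢ.∣ (D ℤ.- + 1)) → OmegaView s

  4∤D-1 : ∀ r q → D ≡ r ℤ.+ q ℤ.* + 4 → ¬ (4 ℕᵈ.∣ ℤ.∣ r ℤ.- + 1 ∣) → ¬ (+ 4 ℤˢ.∣ (D ℤ.- + 1))
  4∤D-1 r q D≡r+4q 4∤r-1 (ℤˢ.divides k D-1≡4k) = no-multiple (r ℤ.- + 1) q k 4∤r-1 (≡.trans
    (ℤS.solve 2 (λ q r → q ℤS.:* ℤS.con (+ 4) ℤS.:+ (r ℤS.:- ℤS.con (+ 1)) ℤS.:=
      r ℤS.:+ q ℤS.:* ℤS.con (+ 4) ℤS.:- ℤS.con (+ 1)) ≡.refl q r)
    (≡.trans (≡.cong (λ x → x ℤ.- + 1) (≡.sym D≡r+4q)) D-1≡4k))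

  omega-view : OmegaView (omega D s)
  -- Abstracting `D %ℕ 4` also makes `omega D s` in the goal reduce to one of its two forms.
  omega-view with D ℤ.%ℕ 4 | a≡a%ℕn+[a/ℕn]*n D 4 | n%ℕd<d D 4
  ... | 0 | eq | _ = root (4∤D-1 (+ 0) (D ℤ./ℕ 4) eq (from-no (4 ℕᵈ.∣? 1)))
  ... | 1 | eq | _ = half (D ℤ./ℕ 4) eq
  ... | 2 | eq | _ = root (4∤D-1 (+ 2) (D ℤ./ℕ 4) eq (from-no (4 ℕᵈ.∣? 1)))
  ... | 3 | eq | _ = root (4∤D-1 (+ 3) (D ℤ./ℕ 4) eq (from-no (4 ℕᵈ.∣? 2)))
  ... | suc (suc (suc (suc _))) | _ | s≤s (s≤s (s≤s (s≤s ())))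

  Conclusion₂ Conclusion₃ : Carrier → Set ℓ
  Conclusion₂ ω = ∀ a b n g → g 1 ≡ + 1 → ¬ (+ 2 ℤˢ.∣ a) →
    ¬ (evalP g n (fromℤ a * ω + fromℤ b) ≈ 0#)
  Conclusion₃ ω = ∀ a b n g → g 1 ≡ + 1 → ¬ (+ 3 ℤˢ.∣ a) →
    (+ 3 ℤˢ.∣ g 3) ⊎ (+ 3 ℤˢ.∣ (g 3 ℤ.- + 1)) →
    ¬ (evalP g n (fromℤ a * ω + fromℤ b) ≈ 0#)

  module Half (e : ℤ) (D≡1+4e : D ≡ + 1 ℤ.+ e ℤ.* + 4) where
    ½ θ : Carrier
    ½ = fromℕ 2 ⁻¹
    θ = (1# + s) * ½

    2½≈1 : fromℕ 2 * ½ ≈ 1#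
    2½≈1 = inverseʳ (fromℕ 2) (charZero 1)

    s²≈1+4e : s * s ≈ 1# + fromℤ e * fromℕ 4
    s²≈1+4e = begin
      s * s                            ≈⟨ s² ⟩
      fromℤ D                          ≡⟨ ≡.cong fromℤ D≡1+4e ⟩
      fromℤ (+ 1 ℤ.+ e ℤ.* + 4)        ≈⟨ fromℤ-+ (+ 1) (e ℤ.* + 4) ⟩
      fromℤ (+ 1) + fromℤ (e ℤ.* + 4)  ≈⟨ +-cong fromℤ-1 (fromℤ-* e (+ 4)) ⟩
      1# + fromℤ e * fromℕ 4           ∎

    -- With s² = 1 + 4e the square is (2 + 2s + 4e)/4, so θ is a root of X² - X - e. Each 2 is
    -- paired with a ½ because ½ is known only through 2 · ½ = 1.
    θ²≈θ+e : θ * θ ≈ fromℤ (+ 1) * θ + fromℤ e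
    θ²≈θ+e = begin
      θ * θ
        ≈⟨ solve 2 (λ s h → (con (+ 1) :+ s) :* h :* ((con (+ 1) :+ s) :* h)
             := (con (+ 1) :+ con (+ 2) :* s :+ s :* s) :* (h :* h)) refl s ½ ⟩
      (1# + fromℕ 2 * s + s * s) * (½ * ½)
        ≈⟨ *-congʳ (+-congˡ s²≈1+4e) ⟩
      (1# + fromℕ 2 * s + (1# + fromℤ e * fromℕ 4)) * (½ * ½)
        ≈⟨ solve 3 (λ s h e → (con (+ 1) :+ con (+ 2) :* s :+ (con (+ 1) :+ e :* con (+ 4))) :* (h :* h)
             := con (+ 2) :* h :* ((con (+ 1) :+ s) :* h) :+ con (+ 2) :* h :* (con (+ 2) :* h) :* e)
             refl s ½ (fromℤ e) ⟩
      fromℕ 2 * ½ * θ + fromℕ 2 * ½ * (fromℕ 2 * ½) * fromℤ e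
        ≈⟨ +-cong (*-congʳ (trans 2½≈1 (sym fromℤ-1)))
             (trans (*-congʳ (trans (*-cong 2½≈1 2½≈1) (*-identityˡ 1#))) (*-identityˡ _)) ⟩
      fromℤ (+ 1) * θ + fromℤ e ∎

    open Quadratic.MonicRoot K θ (+ 1) e θ²≈θ+e

    θ²-θ≈e : θ * θ - θ ≈ fromℤ e
    θ²-θ≈e = trans (+-congʳ (trans θ²≈θ+e (+-congʳ (*-congʳ fromℤ-1))))
      (solve 2 (λ θ e → con (+ 1) :* θ :+ e :- θ := e) refl θ (fromℤ e))

    stable-θ-1 : Stable basis (θ - 1#)
    stable-θ-1 = stable-+ θ-stable (stable-neg stable-1)

    -- The conjugate of θ is 1 - θ. Here and in the next two lemmas the cofactor is the conjugate up
    -- to sign, and the integer is the norm up to sign.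
    θ-coprime : ∀ p → ¬ (+ p ℤˢ.∣ e) → Coprime p θ
    θ-coprime p p∤e = θ - 1# , e , stable-θ-1 ,
      trans (solve 1 (λ θ → θ :* (θ :- con (+ 1)) := θ :* θ :- θ) refl θ) θ²-θ≈e , p∤e

    θ-1-coprime : ∀ p → ¬ (+ p ℤˢ.∣ e) → Coprime p (θ - 1#)
    θ-1-coprime p p∤e = θ , e , θ-stable ,
      trans (solve 1 (λ θ → (θ :- con (+ 1)) :* θ := θ :* θ :- θ) refl θ) θ²-θ≈e , p∤e

    θ+1-coprime : ∀ p → ¬ (+ p ℤˢ.∣ (e ℤ.- + 2)) → Coprime p (θ + 1#)
    θ+1-coprime p p∤e-2 = θ - fromℕ 2 , e ℤ.- + 2 ,
      stable-+ θ-stable (stable-neg (stable-fromℤ (+ 2))) ,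
      trans (solve 1 (λ θ → (θ :+ con (+ 1)) :* (θ :- con (+ 2)) := θ :* θ :- θ :- con (+ 2)) refl θ)
        (trans (+-congʳ θ²-θ≈e) (sym (fromℤ-+ e (ℤ.- + 2)))) , p∤e-2

    conclusion₂ : + 8 ℤˢ.∣ (D ℤ.- + 5) → Conclusion₂ θ
    conclusion₂ (ℤˢ.divides j D-5≡8j) a b n g g1 2∤a =
      nonvanishing₂ a b n g g1 2∤a (θ-coprime 2 2∤e) (θ-1-coprime 2 2∤e)
      where
      -- Here D - 5 = 4e - 4; an even e = 2i would make it 8i - 4, not a multiple of 8.
      2∤e : ¬ (+ 2 ℤˢ.∣ e)
      2∤e (ℤˢ.divides i e≡2i) = no-multiple (ℤ.- + 4) i j (from-no (8 ℕᵈ.∣? 4)) (≡.trans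
        (ℤS.solve 1 (λ i → i ℤS.:* ℤS.con (+ 8) ℤS.:+ ℤS.con (ℤ.- + 4) ℤS.:=
          ℤS.con (+ 1) ℤS.:+ i ℤS.:* ℤS.con (+ 2) ℤS.:* ℤS.con (+ 4) ℤS.:- ℤS.con (+ 5)) ≡.refl i)
        (≡.trans (≡.cong (λ x → + 1 ℤ.+ x ℤ.* + 4 ℤ.- + 5) (≡.sym e≡2i))
          (≡.trans (≡.cong (λ x → x ℤ.- + 5) (≡.sym D≡1+4e)) D-5≡8j)))

    conclusion₃ : + 3 ℤˢ.∣ (D ℤ.- + 2) → Conclusion₃ θ
    conclusion₃ (ℤˢ.divides j D-2≡3j) a b n g g1 3∤a g3 = nonvanishing₃ a b n g g1 3∤a g3
      (θ-coprime 3 3∤e) (θ+1-coprime 3 3∤e-2) (θ-1-coprime 3 3∤e)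
      where
      -- Here D - 2 = 4e - 1, which for e = 3i is 12i - 1.
      3∤e : ¬ (+ 3 ℤˢ.∣ e)
      3∤e (ℤˢ.divides i e≡3i) = no-multiple (ℤ.- + 1) (i ℤ.* + 4) j (from-no (3 ℕᵈ.∣? 1)) (≡.trans
        (ℤS.solve 1 (λ i → i ℤS.:* ℤS.con (+ 4) ℤS.:* ℤS.con (+ 3) ℤS.:+ ℤS.con (ℤ.- + 1) ℤS.:=
          ℤS.con (+ 1) ℤS.:+ i ℤS.:* ℤS.con (+ 3) ℤS.:* ℤS.con (+ 4) ℤS.:- ℤS.con (+ 2)) ≡.refl i)
        (≡.trans (≡.cong (λ x → + 1 ℤ.+ x ℤ.* + 4 ℤ.- + 2) (≡.sym e≡3i))
          (≡.trans (≡.cong (λ x → x ℤ.- + 2) (≡.sym D≡1+4e)) D-2≡3j)))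
      -- For e = 3i + 2 the same difference 4e - 1 is 12i + 7, again prime to 3.
      3∤e-2 : ¬ (+ 3 ℤˢ.∣ (e ℤ.- + 2))
      3∤e-2 (ℤˢ.divides i e-2≡3i) = no-multiple (+ 7) (i ℤ.* + 4) j (from-no (3 ℕᵈ.∣? 7)) (≡.trans
        (ℤS.solve 1 (λ i → i ℤS.:* ℤS.con (+ 4) ℤS.:* ℤS.con (+ 3) ℤS.:+ ℤS.con (+ 7) ℤS.:=
          i ℤS.:* ℤS.con (+ 3) ℤS.:* ℤS.con (+ 4) ℤS.:+ ℤS.con (+ 7)) ≡.refl i)
        (≡.trans (≡.cong (λ x → x ℤ.* + 4 ℤ.+ + 7) (≡.sym e-2≡3i)) (≡.trans
          (ℤS.solve 1 (λ e → (e ℤS.:- ℤS.con (+ 2)) ℤS.:* ℤS.con (+ 4) ℤS.:+ ℤS.con (+ 7) ℤS.:=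
            ℤS.con (+ 1) ℤS.:+ e ℤS.:* ℤS.con (+ 4) ℤS.:- ℤS.con (+ 2)) ≡.refl e)
          (≡.trans (≡.cong (λ x → x ℤ.- + 2) (≡.sym D≡1+4e)) D-2≡3j))))

  module Root where

    open Quadratic.MonicRoot K s (+ 0) D
      (trans s² (solve 2 (λ s d → d := con (+ 0) :* s :+ d) refl s (fromℤ D)))

    -- One product certifies both s - 1 and s + 1, each being the cofactor of the other; D ≡ 2
    -- modulo 3 makes D - 1 ≡ 1.
    s²-1≈D-1 : (s - 1#) * (s + 1#) ≈ fromℤ (D ℤ.- + 1)
    s²-1≈D-1 = trans (solve 1 (λ s → (s :- con (+ 1)) :* (s :+ con (+ 1)) := s :* s :- con (+ 1)) refl s)
      (trans (+-cong s² (-‿cong (sym fromℤ-1))) (sym (fromℤ-+ D (ℤ.- + 1))))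

    conclusion₃ : + 3 ℤˢ.∣ (D ℤ.- + 2) → Conclusion₃ s
    conclusion₃ (ℤˢ.divides j D-2≡3j) a b n g g1 3∤a g3 = nonvanishing₃ a b n g g1 3∤a g3
      (s , D , θ-stable , s² , 3∤D)
      (s - 1# , D ℤ.- + 1 , stable-+ θ-stable (stable-neg stable-1) , trans (*-comm _ _) s²-1≈D-1 , 3∤D-1)
      (s + 1# , D ℤ.- + 1 , stable-+ θ-stable stable-1 , s²-1≈D-1 , 3∤D-1)
      where
      3∤D : ¬ (+ 3 ℤˢ.∣ D)
      3∤D (ℤˢ.divides i D≡3i) = no-multiple (ℤ.- + 2) i j (from-no (3 ℕᵈ.∣? 2))
        (≡.trans (≡.cong (λ x → x ℤ.- + 2) (≡.sym D≡3i)) D-2≡3j)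
      3∤D-1 : ¬ (+ 3 ℤˢ.∣ (D ℤ.- + 1))
      3∤D-1 (ℤˢ.divides i D-1≡3i) = no-multiple (ℤ.- + 1) i j (from-no (3 ℕᵈ.∣? 1))
        (≡.trans (≡.cong (λ x → x ℤ.- + 1) (≡.sym D-1≡3i)) (≡.trans
          (ℤS.solve 1 (λ d → d ℤS.:- ℤS.con (+ 1) ℤS.:- ℤS.con (+ 1) ℤS.:= d ℤS.:- ℤS.con (+ 2)) ≡.refl D)
          D-2≡3j))

  omega-conclusion₂ : ∀ {ω} → OmegaView ω → + 8 ℤˢ.∣ (D ℤ.- + 5) → Conclusion₂ ω
  omega-conclusion₂ (half e D≡1+4e) 8∣D-5                    = Half.conclusion₂ e D≡1+4e 8∣D-5
  omega-conclusion₂ (root 4∤D-1)    (ℤˢ.divides j D-5≡8j) = contradiction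
    -- D = 5 + 8j gives D - 1 = 4(2j + 1), so D ≡ 1 modulo 4 and ω_D has the half-integral form.
    (ℤˢ.divides (+ 2 ℤ.* j ℤ.+ + 1) (≡.trans
      (ℤS.solve 1 (λ d → d ℤS.:- ℤS.con (+ 1) ℤS.:= d ℤS.:- ℤS.con (+ 5) ℤS.:+ ℤS.con (+ 4)) ≡.refl D)
      (≡.trans (≡.cong (λ x → x ℤ.+ + 4) D-5≡8j)
        (ℤS.solve 1 (λ j → j ℤS.:* ℤS.con (+ 8) ℤS.:+ ℤS.con (+ 4) ℤS.:=
          (ℤS.con (+ 2) ℤS.:* j ℤS.:+ ℤS.con (+ 1)) ℤS.:* ℤS.con (+ 4)) ≡.refl j))))
    4∤D-1

  omega-conclusion₃ : ∀ {ω} → OmegaView ω → + 3 ℤˢ.∣ (D ℤ.- + 2) → Conclusion₃ ω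
  omega-conclusion₃ (half e D≡1+4e) = Half.conclusion₃ e D≡1+4e
  omega-conclusion₃ (root _)        = Root.conclusion₃

-- Nonvanishing at cyclotomic and quadratic integers

theorem5 : ∀ {c ℓ} (K : CharZeroField c ℓ) →
    let open CharZeroField K
        open FieldOps K
    in (a b : ℤ) (n : ℕ) (g : ℕ → ℤ) → g 1 ≡ + 1 →
       -- parts 1 and 2: α = a ζ_m + b
       ((m : ℕ) (ζ : Carrier) → 3 ℕ.≤ m → PrimitiveRoot m ζ →
          ((∃[ p ] (Prime p × p ≢ 2 × p ℕᵈ.∣ m)) →
             ¬ ((+ 2) ℤᵈ.∣ a) →
             ¬ (evalP g n ((fromℤ a * ζ) + fromℤ b) ≈ 0#))
          ×
          (((∃[ p ] (Prime p × 3 ℕ.< p × p ℕᵈ.∣ m)) ⊎ (4 ℕᵈ.∣ m)) →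
             ¬ ((+ 3) ℤᵈ.∣ a) →
             (((+ 3) ℤᵈ.∣ g 3) ⊎ ((+ 3) ℤᵈ.∣ (g 3 ℤ.- + 1))) →
             ¬ (evalP g n ((fromℤ a * ζ) + fromℤ b) ≈ 0#)))
       ×
       -- parts 3 and 4: α = a ω_D + b, where s is a square root of D in K
       ((D : ℤ) (s : Carrier) → SquareFree D → D ≢ + 0 → D ≢ + 1 → IsSqrt D s →
          (((+ 8) ℤᵈ.∣ (D ℤ.- + 5)) →
             ¬ ((+ 2) ℤᵈ.∣ a) →
             ¬ (evalP g n ((fromℤ a * omega D s) + fromℤ b) ≈ 0#))
          ×
          (((+ 3) ℤᵈ.∣ (D ℤ.- + 2)) →
             ¬ ((+ 3) ℤᵈ.∣ a) →
             (((+ 3) ℤᵈ.∣ g 3) ⊎ ((+ 3) ℤᵈ.∣ (g 3 ℤ.- + 1))) →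
             ¬ (evalP g n ((fromℤ a * omega D s) + fromℤ b) ≈ 0#)))
theorem5 K a b n g g1 =
  -- The bound 3 ≤ m rules out m = 0, which leaves the successor form that `Cyclotomic` expects.
  (λ { (suc m) ζ _ ζ-root →
       let open Cyclotomic K m ζ ζ-root in
       (λ (p , p-prime , p≢2 , p∣m) 2∤a → nonvanishing₂ a b n g g1 (2∤a ∘ ℤˢ.∣⇒∣ᵤ)
          (ζ-coprime 2 (from-no (2 ℕᵈ.∣? 1))) (ζ-1-coprime₂ p-prime p≢2 p∣m)) ,
       (λ m-hyp 3∤a g3 → nonvanishing₃ a b n g g1 (3∤a ∘ ℤˢ.∣⇒∣ᵤ) (Sum.map ℤˢ.∣ᵤ⇒∣ ℤˢ.∣ᵤ⇒∣ g3)
          (ζ-coprime 3 (from-no (3 ℕᵈ.∣? 1)))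
          (ζ+1-coprime₃ (ζ²-1-coprime m-hyp)) (ζ-1-coprime₃ (ζ²-1-coprime m-hyp))) }) ,
  (λ D s _ _ _ s² →
     let open QuadraticField K D s s² in
     (λ 8∣D-5 2∤a → omega-conclusion₂ omega-view (ℤˢ.∣ᵤ⇒∣ 8∣D-5) a b n g g1 (2∤a ∘ ℤˢ.∣⇒∣ᵤ)) ,
     (λ 3∣D-2 3∤a g3 → omega-conclusion₃ omega-view (ℤˢ.∣ᵤ⇒∣ 3∣D-2) a b n g g1 (3∤a ∘ ℤˢ.∣⇒∣ᵤ)
        (Sum.map ℤˢ.∣ᵤ⇒∣ ℤˢ.∣ᵤ⇒∣ g3)))
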